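{- Let $N\ge2$ be an integer and $b_1,\dots,b_N\in\mathbb{Q}$ with $b_N\neq0$ and $b_{N-1}+b_N=-1$, and let $b\in\mathbb{Q}$. Let \[R(x_1,\dots,x_N):=(1+x_1)^{b_1}(1+x_1+x_2)^{b_2}\cdots(1+x_1+\dots+x_N)^{b_N},\] and $B(k):=-(b_k+\dots+b_N)$. For $k=1,\dots,N-2$ let \[u^k:=\left(\tfrac{B(k)-b}{N-k+1},\tfrac{B(k)-b+1}{N-k+1},\dots,\tfrac{B(k)-b+N-k}{N-k+1}\right),\quad v^k:=\left(\tfrac{B(k)-b}{N-k},\tfrac{B(k)-b+1}{N-k},\dots,\tfrac{B(k)-b+N-k-1}{N-k}\right),\] let $u^{N-1}:=(1-b)/2$, $u^N:=-b_N$, and let $v^{N-1}:=(1,\dots,1)$ consist of exactly $N-1$ ones. Let $u:=(u^1,\dots,u^N)$ (of length $M-1$, where $M:=N(N+1)/2$) and $v:=(v^1,\dots,v^{N-1})$ (of length $M-2$). Then \[\operatorname{Diag}\big((1+x_1+\dots+x_{N-2}+2x_{N-1})^b\cdot R(x_1,\dots,x_N)\big)={}_{M-1}F_{M-2}(u;v;(-N)^Nt).\]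
   Context: All power series have coefficients in $\mathbb{Q}$. For $a\in\mathbb{Q}$ and a power series $L$ with zero constant term, $(1+L)^a:=\sum_{j\ge0}\binom{a}{j}L^j$ with $\binom{a}{j}=a(a-1)\cdots(a-j+1)/j!$. For $g=\sum g_{i_1,\dots,i_N}x_1^{i_1}\cdots x_N^{i_N}$, $\operatorname{Diag}(g):=\sum_{j\ge0}g_{j,\dots,j}t^j$. For tuples $u=(a_1,\dots,a_p)$, $v=(b_1,\dots,b_q)$, ${}_pF_q(u;v;t):=\sum_{j\ge0}\frac{(a_1)_j\cdots(a_p)_j}{(b_1)_j\cdots(b_q)_j}\frac{t^j}{j!}$ with $(x)_j=x(x+1)\cdots(x+j-1)$, defined when no $b_i+j$ ($j\in\mathbb{N}$) vanishes. -}

module Defs where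

open import Data.Nat as ℕ using (ℕ; zero; suc; _∸_)
open import Data.Integer as ℤ using (+_)
open import Data.Rational as ℚ using (ℚ; 0ℚ; 1ℚ; _+_; _*_; _-_; -_; _÷_; _≟_; _/_)
open import Data.Fin using (Fin; toℕ)
open import Data.Vec as Vec using (Vec; []; _∷_; tabulate)
open import Data.Vec.Properties using (≡-dec)
open import Data.List as List using (List; []; _∷_; _++_; map; concatMap; upTo; foldr; replicate)
open import Data.Bool using (if_then_else_)
open import Relation.Nullary using (yes; no; does)
open import Relation.Binary.PropositionalEquality using (_≢_)
open import Data.List.Relation.Unary.All using (All)

ℕ→ℚ : ℕ → ℚ
ℕ→ℚ n = + n / 1

-- division by a natural number (only ever used with nonzero divisor)
_/ℕ_ : ℚ → ℕ → ℚ
q /ℕ zero    = 0ℚ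
q /ℕ (suc m) = q * (+ 1 / suc m)

-- division, totalised by p ÷' 0 = 0 (only used when the divisor is nonzero)
_÷'_ : ℚ → ℚ → ℚ
p ÷' q with q ≟ 0ℚ
... | yes _   = 0ℚ
... | no  q≢0 = _÷_ p q {{ℚ.≢-nonZero q≢0}}

sumℚ : List ℚ → ℚ
sumℚ = foldr _+_ 0ℚ

prodℚ : List ℚ → ℚ
prodℚ = foldr _*_ 1ℚ

_^ℚ_ : ℚ → ℕ → ℚ
q ^ℚ zero  = 1ℚ
q ^ℚ suc n = q * (q ^ℚ n)

factℚ : ℕ → ℚ
factℚ n = prodℚ (map (λ i → ℕ→ℚ (suc i)) (upTo n))

poch : ℚ → ℕ → ℚ
poch x j = prodℚ (map (λ i → x + ℕ→ℚ i) (upTo j))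

binomℚ : ℚ → ℕ → ℚ
binomℚ a j = prodℚ (map (λ i → a - ℕ→ℚ i) (upTo j)) ÷' factℚ j

-- Formal power series in n variables over ℚ, as coefficient functions
-- on exponent vectors (i₁,…,iₙ).

PS : ℕ → Set
PS n = Vec ℕ n → ℚ

below : ∀ {n} → Vec ℕ n → List (Vec ℕ n)
below []      = [] ∷ []
below (a ∷ α) = concatMap (λ i → map (i ∷_) (below α)) (upTo (suc a))

_-v_ : ∀ {n} → Vec ℕ n → Vec ℕ n → Vec ℕ n
_-v_ = Vec.zipWith _∸_

deg : ∀ {n} → Vec ℕ n → ℕ
deg = Vec.foldr _ ℕ._+_ 0

-- the exponent vector of the monomial x_i (1-based index i)
unit : ∀ {n} → ℕ → Vec ℕ n
unit i = tabulate (λ j → if does (suc (toℕ j) ℕ.≟ i) then 1 else 0)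

zeroV : ∀ {n} → Vec ℕ n
zeroV = Vec.replicate _ 0

oneS : ∀ {n} → PS n
oneS α with ≡-dec ℕ._≟_ α zeroV
... | yes _ = 1ℚ
... | no  _ = 0ℚ

-- the variable x_i (1-based)
X : ∀ {n} → ℕ → PS n
X i α with ≡-dec ℕ._≟_ α (unit i)
... | yes _ = 1ℚ
... | no  _ = 0ℚ

_⊕_ : ∀ {n} → PS n → PS n → PS n
(f ⊕ g) α = f α + g α

zeroS : ∀ {n} → PS n
zeroS _ = 0ℚ

_⊛_ : ∀ {n} → PS n → PS n → PS n
(f ⊛ g) α = sumℚ (map (λ β → f β * g (α -v β)) (below α))

sumS : ∀ {n} → List (PS n) → PS n
sumS = foldr _⊕_ zeroS

prodS : ∀ {n} → List (PS n) → PS n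
prodS = foldr _⊛_ oneS

_^S_ : ∀ {n} → PS n → ℕ → PS n
f ^S zero  = oneS
f ^S suc j = f ⊛ (f ^S j)

-- (1 + L)^a := Σ_j binom(a,j) L^j, for L with zero constant term.
-- The coefficient at α only receives contributions from j ≤ deg α
-- (L^j has no monomials of degree < j), so the sum is finite.
onePlusPow : ∀ {n} → ℚ → PS n → PS n
onePlusPow a L α = sumℚ (map (λ j → binomℚ a j * (L ^S j) α) (upTo (suc (deg α))))

partialSum : ∀ {n} → ℕ → PS n
partialSum k = sumS (map (λ i → X (suc i)) (upTo k))

Diag : ∀ {n} → PS n → ℕ → ℚ
Diag g j = g (Vec.replicate _ j)

HypDefined : List ℚ → Set
HypDefined vs = All (λ x → ∀ (j : ℕ) → x + ℕ→ℚ j ≢ 0ℚ) vs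

hypCoeff : List ℚ → List ℚ → ℚ → ℕ → ℚ
hypCoeff us vs c j =
  (prodℚ (map (λ a → poch a j) us) ÷' (prodℚ (map (λ b → poch b j) vs) * factℚ j)) * (c ^ℚ j)

-- 1-based access b_k to a vector (b_1,…,b_N); 0 outside the range (never used there)
at : ∀ {n} → Vec ℚ n → ℕ → ℚ
at []       _             = 0ℚ
at (x ∷ xs) zero          = 0ℚ
at (x ∷ xs) (suc zero)    = x
at (x ∷ xs) (suc (suc k)) = at xs (suc k)

R : ∀ {N} → Vec ℚ N → PS N
R {N} bs = prodS (map (λ i → onePlusPow (at bs (suc i)) (partialSum (suc i))) (upTo N))

Bk : ∀ {N} → Vec ℚ N → ℕ → ℚ
Bk {N} bs k = - sumℚ (map (λ i → at bs (k ℕ.+ i)) (upTo (suc (N ∸ k))))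

uList : ∀ {N} → Vec ℚ N → ℚ → List ℚ
uList {N} bs b =
  concatMap (λ i → let k = suc i in
               map (λ m → (Bk bs k - b + ℕ→ℚ m) /ℕ (N ∸ k ℕ.+ 1)) (upTo (N ∸ k ℕ.+ 1)))
            (upTo (N ∸ 2))
  ++ ((1ℚ - b) /ℕ 2) ∷ (- at bs N) ∷ []

vList : ∀ {N} → Vec ℚ N → ℚ → List ℚ
vList {N} bs b =
  concatMap (λ i → let k = suc i in
               map (λ m → (Bk bs k - b + ℕ→ℚ m) /ℕ (N ∸ k)) (upTo (N ∸ k)))
            (upTo (N ∸ 2))
  ++ replicate (N ∸ 1) 1ℚ

module Submission where

-- The coefficient of xʲ in (S + c x)^a is binom(a,j) cʲ S^(a-j), and for c = 0 a factor
-- passes through unchanged.  So x_N, …, x_1 can be taken out one at a time, each but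
-- x_(N-1) leaving one binomial coefficient.  With S = 1+x_1+…+x_(N-2) and y = x_(N-1) the
-- hypothesis b_(N-1)+b_N = -1 makes the remaining step (S+2y)^b (S+y)^(-1-j), whose
-- coefficient of yʲ is 4ʲ binom((b-1)/2, j) S^(b-1-2j).  The other binomial coefficients are
-- quotients of Pochhammer symbols (x)_{(M+1)j} / (x)_{Mj}, which Gauss's multiplication
-- formula splits into u^k and v^k; the powers (M+1)^((M+1)j) / M^(Mj) telescope.

open import Algebra.Bundles using (CommutativeRing)
open import Algebra.Structures using (IsCommutativeRing)
import Algebra.Solver.Ring as RingSolver
import Algebra.Solver.Ring.AlmostCommutativeRing as ACR
open import Data.Bool using (if_then_else_)
open import Data.Fin using (toℕ)
import Data.Integer as ℤ
import Data.Integer.Properties as ℤP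
open import Data.List using (List; []; _∷_; _++_; map; concatMap; upTo; foldr; replicate; applyUpTo)
import Data.List.Properties as L
open import Data.Nat as ℕ using (ℕ; zero; suc; _≤_; _∸_)
import Data.Nat.Properties as ℕP
import Data.Nat.Tactic.RingSolver as ℕR
open import Data.Product using (∃; _,_; proj₁; proj₂)
open import Data.Rational as ℚ using (ℚ; 0ℚ; 1ℚ)
import Data.Rational.Properties as ℚP
import Data.Rational.Unnormalised as ℚᵘ
import Data.Rational.Unnormalised.Properties as ℚᵘP
open import Data.Vec as Vec using (Vec; []; _∷_; _∷ʳ_; tabulate)
open import Data.Vec.Properties using (≡-dec; ∷-injective; ∷ʳ-injective)
open import Data.List.Relation.Unary.All as All using (All; []; _∷_)
open import Function using (id)
open import Level using (0ℓ)
open import Relation.Nullary using (yes; no; does; contradiction)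
open import Relation.Nullary.Decidable using (dec-true; dec-false)
open import Relation.Binary.Consequences using (dec⇒weaklyDec)
open import Relation.Binary.PropositionalEquality
  using (_≡_; _≢_; refl; sym; trans; cong; cong₂; module ≡-Reasoning)

open import Defs

-- The exponents are arbitrary rationals, so no power can be expanded as a finite product. Each
-- closed form is reached instead through the recurrence that differentiation gives for its
-- coefficients, with the factor `j + 1` cancelled.
--
-- The middle step is the delicate one. The exponent -1-j of `S + y` moves with the index j of the
-- wanted coefficient, so the values for different j come from different series, and a recurrence
-- along one series does not link them. At a fixed exponent the coefficients obey a three-term
-- recurrence. At exactly the exponent that occurs its two coefficients agree, and Pascal's rule
-- passes to the next series. The resulting ratio of consecutive values is -4((1-b)/2 + j) over j+1.
--
-- The constants then balance. Each of the N variables contributes one sign (-1)^j and one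
-- denominator j!. The signs make up the sign of (-N)^(Nj), and the factorials are the N-1 ones in v
-- together with the j! of the series. The product of the powers M^(Mj) telescopes from M = N down
-- to M = 2, and the 4^j of the middle step is exactly its lower end.

module Diagonal where

  -- Opaque rational arithmetic and its ring solver

  infixl 6 _+_
  infixl 7 _*_
  infix  8 -_

  -- ℚ's operations match on their record arguments, so the unifier would unfold
  -- them; opaque copies are injective for unification.
  opaque
    _+_ _*_ : ℚ → ℚ → ℚ
    _+_ = ℚ._+_
    _*_ = ℚ._*_

    -_ : ℚ → ℚ
    -_ = ℚ.-_

  sum prod : List ℚ → ℚ
  sum  = foldr _+_ 0ℚ
  prod = foldr _*_ 1ℚ

  opaque
    unfolding _+_

    isCommutativeRing : IsCommutativeRing _≡_ _+_ _*_ -_ 0ℚ 1ℚ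
    isCommutativeRing = ℚP.+-*-isCommutativeRing

    -- Normalising `+ n / 1` involves a gcd that is stuck on a variable `n`. The equation is
    -- therefore checked on unnormalised fractions, where it becomes an identity of integers.
    ℕ→ℚ-suc : ∀ n → ℕ→ℚ (suc n) ≡ 1ℚ + ℕ→ℚ n
    ℕ→ℚ-suc n = ℚP.toℚᵘ-injective (begin
      ℚ.toℚᵘ (ℕ→ℚ (suc n))             ≈⟨ ℚP.toℚᵘ-fromℚᵘ (ℚᵘ.mkℚᵘ (ℤ.+ suc n) 0) ⟩
      ℚᵘ.mkℚᵘ (ℤ.+ suc n) 0            ≈⟨ ℚᵘ.*≡* (cong (λ i → (ℤ.+ 1 ℤ.+ i) ℤ.* ℤ.+ 1) (sym (ℤP.*-identityʳ (ℤ.+ n)))) ⟩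
      ℚᵘ.1ℚᵘ ℚᵘ.+ ℚᵘ.mkℚᵘ (ℤ.+ n) 0    ≈⟨ ℚᵘP.+-congʳ ℚᵘ.1ℚᵘ (ℚP.toℚᵘ-fromℚᵘ (ℚᵘ.mkℚᵘ (ℤ.+ n) 0)) ⟨
      ℚᵘ.1ℚᵘ ℚᵘ.+ ℚ.toℚᵘ (ℕ→ℚ n)       ≈⟨ ℚP.toℚᵘ-homo-+ 1ℚ (ℕ→ℚ n) ⟨
      ℚ.toℚᵘ (1ℚ ℚ.+ ℕ→ℚ n)            ∎)
      where open ℚᵘP.≃-Reasoning

    ℚ-inverse : ∀ {c} → c ≢ 0ℚ → ∃ λ d → c * d ≡ 1ℚ
    ℚ-inverse {c} c≢0 = ℚ.1/_ c {{ℚ.≢-nonZero c≢0}} , ℚP.*-inverseʳ c {{ℚ.≢-nonZero c≢0}}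

    ÷'-* : ∀ p {q} → q ≢ 0ℚ → (p ÷' q) * q ≡ p
    ÷'-* p {q} q≢0 with q ℚ.≟ 0ℚ
    ... | yes q≡0 = contradiction q≡0 q≢0
    ... | no  q≢0 = trans (ℚP.*-assoc p (ℚ.1/_ q {{i}}) q)
      (trans (cong (p ℚ.*_) (ℚP.*-inverseˡ q {{i}})) (ℚP.*-identityʳ p))
      where
      i : ℚ.NonZero q
      i = ℚ.≢-nonZero q≢0

    -- This equation and those named `-def` restate the definitions in terms of the opaque
    -- operations. They hold by `refl` only here, where these operations are unfolded.
    ^ℚ-suc : ∀ q n → q ^ℚ suc n ≡ q * (q ^ℚ n)
    ^ℚ-suc q n = refl

    factℚ-def : ∀ j → factℚ j ≡ prod (map (λ i → ℕ→ℚ (suc i)) (upTo j))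
    factℚ-def j = refl

    poch-def : ∀ x j → poch x j ≡ prod (map (λ i → x + ℕ→ℚ i) (upTo j))
    poch-def x j = refl

    binomℚ-def : ∀ a j → binomℚ a j ≡ prod (map (λ i → a + - ℕ→ℚ i) (upTo j)) ÷' factℚ j
    binomℚ-def a j = refl

    onePlusPow-def : ∀ {n} a (L : PS n) α →
      onePlusPow a L α ≡ sum (map (λ j → binomℚ a j * (L ^S j) α) (upTo (suc (deg α))))
    onePlusPow-def a L α = refl

    ⊕-def : ∀ {n} (f g : PS n) α → (f ⊕ g) α ≡ f α + g α
    ⊕-def f g α = refl

    ⊛-def : ∀ {n} (f g : PS n) α → (f ⊛ g) α ≡ sum (map (λ β → f β * g (α -v β)) (below α))
    ⊛-def f g α = refl

    /ℕ-* : ∀ q m → (q /ℕ suc m) * ℕ→ℚ (suc m) ≡ q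
    /ℕ-* q m = trans (ℚP.*-assoc q _ _) (trans (cong (q ℚ.*_) inverse) (ℚP.*-identityʳ q))
      where
      inverse : (ℤ.+ 1 ℚ./ suc m) ℚ.* ℕ→ℚ (suc m) ≡ 1ℚ
      inverse = ℚP.toℚᵘ-injective (begin
        ℚ.toℚᵘ ((ℤ.+ 1 ℚ./ suc m) ℚ.* ℕ→ℚ (suc m))
          ≈⟨ ℚP.toℚᵘ-homo-* (ℤ.+ 1 ℚ./ suc m) (ℕ→ℚ (suc m)) ⟩
        ℚ.toℚᵘ (ℤ.+ 1 ℚ./ suc m) ℚᵘ.* ℚ.toℚᵘ (ℕ→ℚ (suc m))
          ≈⟨ ℚᵘP.*-cong (ℚP.toℚᵘ-fromℚᵘ (ℚᵘ.mkℚᵘ (ℤ.+ 1) m)) (ℚP.toℚᵘ-fromℚᵘ (ℚᵘ.mkℚᵘ (ℤ.+ suc m) 0)) ⟩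
        ℚᵘ.mkℚᵘ (ℤ.+ 1) m ℚᵘ.* ℚᵘ.mkℚᵘ (ℤ.+ suc m) 0
          ≈⟨ ℚᵘP.*-inverseˡ (ℚᵘ.mkℚᵘ (ℤ.+ suc m) 0) ⟩
        ℚᵘ.1ℚᵘ ∎)
        where open ℚᵘP.≃-Reasoning

    Bk-def : ∀ {N} (bs : Vec ℚ N) k → Bk bs k ≡ - sum (map (λ i → at bs (k ℕ.+ i)) (upTo (suc (N ∸ k))))
    Bk-def bs k = refl

    uList-def : ∀ {N} (bs : Vec ℚ N) b → uList bs b ≡
      concatMap (λ i → map (λ m → (Bk bs (suc i) + - b + ℕ→ℚ m) /ℕ (N ∸ suc i ℕ.+ 1)) (upTo (N ∸ suc i ℕ.+ 1))) (upTo (N ∸ 2))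
      ++ ((1ℚ + - b) /ℕ 2) ∷ (- at bs N) ∷ []
    uList-def bs b = refl

    vList-def : ∀ {N} (bs : Vec ℚ N) b → vList bs b ≡
      concatMap (λ i → map (λ m → (Bk bs (suc i) + - b + ℕ→ℚ m) /ℕ (N ∸ suc i)) (upTo (N ∸ suc i))) (upTo (N ∸ 2))
      ++ replicate (N ∸ 1) 1ℚ
    vList-def bs b = refl

    hypCoeff-def : ∀ us vs c j → hypCoeff us vs c j ≡
      (prod (map (λ a → poch a j) us) ÷' (prod (map (λ a → poch a j) vs) * factℚ j)) * (c ^ℚ j)
    hypCoeff-def us vs c j = refl

    HypDefined-def : ∀ {vs} → HypDefined vs → All (λ x → ∀ j → x + ℕ→ℚ j ≢ 0ℚ) vs
    HypDefined-def d = d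

  open IsCommutativeRing isCommutativeRing
    using (+-assoc; +-comm; +-identityˡ; +-identityʳ; *-assoc; *-comm; *-identityˡ; *-identityʳ;
           distribˡ; distribʳ; zeroˡ; zeroʳ)

  opaqueRing : ACR.AlmostCommutativeRing 0ℓ 0ℓ
  opaqueRing = ACR.fromCommutativeRing (record { isCommutativeRing = isCommutativeRing })

  opaque
    unfolding _+_

    +-homo : ∀ x y → x ℚ.+ y ≡ x + y
    +-homo x y = refl

    *-homo : ∀ x y → x ℚ.* y ≡ x * y
    *-homo x y = refl

    -‿homo : ∀ x → ℚ.- x ≡ - x
    -‿homo x = refl

  -- The solver has to compute with its numerals, which opaque operations would block. So the
  -- coefficients live in the transparent ℚ, the values in the opaque ring, and the identity map is
  -- the homomorphism.
  coefficients : CommutativeRing.rawRing ℚP.+-*-commutativeRing ACR.-Raw-AlmostCommutative⟶ opaqueRing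
  coefficients = record
    { ⟦_⟧    = id
    ; +-homo = +-homo
    ; *-homo = *-homo
    ; -‿homo = -‿homo
    ; 0-homo = refl
    ; 1-homo = refl
    }

  open RingSolver (CommutativeRing.rawRing ℚP.+-*-commutativeRing) opaqueRing coefficients
    (dec⇒weaklyDec ℚ._≟_)
    using (solve; _:+_; _:*_; :-_; con; _:=_)

  open ≡-Reasoning

  -- Finite convolutions

  -- Σ_{i+k=n} T i k; in particular conv n (λ i _ → f i) is Σ_{i≤n} f i.
  conv : ℕ → (ℕ → ℕ → ℚ) → ℚ
  conv zero    T = T 0 0
  conv (suc n) T = T 0 (suc n) + conv n (λ i k → T (suc i) k)

  conv-cong : ∀ n {S T} → (∀ i k → i ℕ.+ k ≡ n → S i k ≡ T i k) → conv n S ≡ conv n T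
  conv-cong zero    e = e 0 0 refl
  conv-cong (suc n) e =
    cong₂ _+_ (e 0 (suc n) refl) (conv-cong n λ i k p → e (suc i) k (cong suc p))

  conv-+ : ∀ n S T → conv n (λ i k → S i k + T i k) ≡ conv n S + conv n T
  conv-+ zero    S T = refl
  conv-+ (suc n) S T = trans (cong₂ _+_ refl (conv-+ n _ _)) (interchange _ _ _ _)
    where
    interchange : ∀ a b c d → (a + b) + (c + d) ≡ (a + c) + (b + d)
    interchange = solve 4 (λ a b c d → (a :+ b) :+ (c :+ d) := (a :+ c) :+ (b :+ d)) refl

  conv-*ˡ : ∀ n c T → conv n (λ i k → c * T i k) ≡ c * conv n T
  conv-*ˡ zero    c T = refl
  conv-*ˡ (suc n) c T = trans (cong₂ _+_ refl (conv-*ˡ n c _)) (sym (distribˡ c _ _))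

  conv-0 : ∀ n {T} → (∀ i k → i ℕ.+ k ≡ n → T i k ≡ 0ℚ) → conv n T ≡ 0ℚ
  conv-0 zero    e = e 0 0 refl
  conv-0 (suc n) e = trans
    (cong₂ _+_ (e 0 (suc n) refl) (conv-0 n λ i k p → e (suc i) k (cong suc p)))
    (+-identityˡ 0ℚ)

  conv-head : ∀ n {T} → (∀ i k → T (suc i) k ≡ 0ℚ) → conv n T ≡ T 0 n
  conv-head zero    e = refl
  conv-head (suc n) e = trans (cong₂ _+_ refl (conv-0 n λ i k _ → e i k)) (+-identityʳ _)

  conv-last : ∀ n T → conv (suc n) T ≡ conv n (λ i k → T i (suc k)) + T (suc n) 0
  conv-last zero    T = refl
  conv-last (suc n) T =
    trans (cong₂ _+_ refl (conv-last n λ i k → T (suc i) k)) (sym (+-assoc (T 0 (suc (suc n))) _ _))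

  conv-flip : ∀ n T → conv n T ≡ conv n (λ i k → T k i)
  conv-flip zero    T = refl
  conv-flip (suc n) T = trans (cong₂ _+_ refl (conv-flip n _))
    (trans (+-comm (T 0 (suc n)) _) (sym (conv-last n λ i k → T k i)))

  -- Both sides sum over all a + b + c = n. The induction separates the terms with a = 0 from those
  -- with a > 0.
  conv-assoc : ∀ n (T : ℕ → ℕ → ℕ → ℚ) →
    conv n (λ m c → conv m (λ a b → T a b c)) ≡ conv n (λ a m → conv m (λ b c → T a b c))
  conv-assoc zero    T = refl
  conv-assoc (suc n) T = trans
    (cong (T 0 0 (suc n) +_) (trans (conv-+ n _ _) (cong₂ _+_ refl (conv-assoc n λ a → T (suc a)))))
    (sym (+-assoc (T 0 0 (suc n)) _ _))

  conv-conv : ∀ m n (T : ℕ → ℕ → ℕ → ℕ → ℚ) →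
    conv m (λ i k → conv n (T i k)) ≡ conv n (λ p q → conv m (λ i k → T i k p q))
  conv-conv m zero    T = refl
  conv-conv m (suc n) T = trans (conv-+ m _ _) (cong₂ _+_ refl (conv-conv m n _))

  sum-applyUpTo : ∀ n (T : ℕ → ℕ → ℚ) → sum (applyUpTo (λ i → T i (n ∸ i)) (suc n)) ≡ conv n T
  sum-applyUpTo zero    T = +-identityʳ _
  sum-applyUpTo (suc n) T = cong₂ _+_ refl (sum-applyUpTo n λ i → T (suc i))

  sum-upTo : ∀ n (T : ℕ → ℕ → ℚ) → sum (map (λ i → T i (n ∸ i)) (upTo (suc n))) ≡ conv n T
  sum-upTo n T = trans (cong sum (L.map-upTo _ (suc n))) (sum-applyUpTo n T)

  sum-++ : ∀ xs ys → sum (xs ++ ys) ≡ sum xs + sum ys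
  sum-++ []       ys = sym (+-identityˡ _)
  sum-++ (x ∷ xs) ys = begin
    x + sum (xs ++ ys)          ≡⟨ cong (x +_) (sum-++ xs ys) ⟩
    x + (sum xs + sum ys)      ≡⟨ +-assoc x _ _ ⟨
    (x + sum xs) + sum ys      ∎

  sum-concatMap : ∀ {A B : Set} (f : B → ℚ) (h : A → List B) xs →
    sum (map f (concatMap h xs)) ≡ sum (map (λ x → sum (map f (h x))) xs)
  sum-concatMap f h []       = refl
  sum-concatMap f h (x ∷ xs) = begin
    sum (map f (h x ++ concatMap h xs))                  ≡⟨ cong sum (L.map-++ f (h x) _) ⟩
    sum (map f (h x) ++ map f (concatMap h xs))          ≡⟨ sum-++ (map f (h x)) _ ⟩
    sum (map f (h x)) + sum (map f (concatMap h xs))    ≡⟨ cong₂ _+_ refl (sum-concatMap f h xs) ⟩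
    sum (map f (h x)) + sum (map (λ x → sum (map f (h x))) xs)  ∎

  vconv : ∀ {n} → Vec ℕ n → (Vec ℕ n → Vec ℕ n → ℚ) → ℚ
  vconv []      T = T [] []
  vconv (a ∷ α) T = conv a (λ i k → vconv α (λ β γ → T (i ∷ β) (k ∷ γ)))

  -- The degree equation is handed on because `onePlusPow` is truncated at the degree of the
  -- monomial: it makes the bounds at `β` and `γ` add up to the bound at `α`.
  vconv-cong : ∀ {n} (α : Vec ℕ n) {S T} →
    (∀ β γ → deg β ℕ.+ deg γ ≡ deg α → S β γ ≡ T β γ) → vconv α S ≡ vconv α T
  vconv-cong []      e = e [] [] refl
  vconv-cong (a ∷ α) e = conv-cong a λ i k p → vconv-cong α λ β γ q →
    e (i ∷ β) (k ∷ γ) (trans (interchange i (deg β) k (deg γ)) (cong₂ ℕ._+_ p q))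
    where
    interchange : ∀ a b c d → (a ℕ.+ b) ℕ.+ (c ℕ.+ d) ≡ (a ℕ.+ c) ℕ.+ (b ℕ.+ d)
    interchange = ℕR.solve-∀

  vconv-cong′ : ∀ {n} (α : Vec ℕ n) {S T} → (∀ β γ → S β γ ≡ T β γ) → vconv α S ≡ vconv α T
  vconv-cong′ α e = vconv-cong α λ β γ _ → e β γ

  vconv-+ : ∀ {n} (α : Vec ℕ n) S T → vconv α (λ β γ → S β γ + T β γ) ≡ vconv α S + vconv α T
  vconv-+ []      S T = refl
  vconv-+ (a ∷ α) S T = trans (conv-cong a λ i k _ → vconv-+ α _ _) (conv-+ a _ _)

  vconv-*ˡ : ∀ {n} (α : Vec ℕ n) c T → vconv α (λ β γ → c * T β γ) ≡ c * vconv α T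
  vconv-*ˡ []      c T = refl
  vconv-*ˡ (a ∷ α) c T = trans (conv-cong a λ i k _ → vconv-*ˡ α c _) (conv-*ˡ a c _)

  vconv-0 : ∀ {n} (α : Vec ℕ n) {T} → (∀ β γ → T β γ ≡ 0ℚ) → vconv α T ≡ 0ℚ
  vconv-0 []      e = e [] []
  vconv-0 (a ∷ α) e = conv-0 a λ i k _ → vconv-0 α λ β γ → e (i ∷ β) (k ∷ γ)

  vconv-conv : ∀ {n} (α : Vec ℕ n) m (T : ℕ → ℕ → Vec ℕ n → Vec ℕ n → ℚ) →
    vconv α (λ β γ → conv m (λ i k → T i k β γ)) ≡ conv m (λ i k → vconv α (T i k))
  vconv-conv α zero    T = refl
  vconv-conv α (suc m) T = trans (vconv-+ α _ _) (cong₂ _+_ refl (vconv-conv α m _))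

  vconv-flip : ∀ {n} (α : Vec ℕ n) T → vconv α T ≡ vconv α (λ β γ → T γ β)
  vconv-flip []      T = refl
  vconv-flip (a ∷ α) T = trans (conv-cong a λ i k _ → vconv-flip α _) (conv-flip a _)

  vconv-assoc : ∀ {n} (α : Vec ℕ n) (T : Vec ℕ n → Vec ℕ n → Vec ℕ n → ℚ) →
    vconv α (λ μ γ → vconv μ (λ β δ → T β δ γ)) ≡ vconv α (λ β μ → vconv μ (λ δ γ → T β δ γ))
  vconv-assoc []      T = refl
  vconv-assoc (a ∷ α) T = begin
    conv a (λ m k → vconv α (λ μ γ → conv m (λ i j → vconv μ (λ β δ → T (i ∷ β) (j ∷ δ) (k ∷ γ)))))
      ≡⟨ conv-cong a (λ m k _ → vconv-conv α m _) ⟩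
    conv a (λ m k → conv m (λ i j → vconv α (λ μ γ → vconv μ (λ β δ → T (i ∷ β) (j ∷ δ) (k ∷ γ)))))
      ≡⟨ conv-cong a (λ m k _ → conv-cong m λ i j _ → vconv-assoc α _) ⟩
    conv a (λ m k → conv m (λ i j → vconv α (λ β μ → vconv μ (λ δ γ → T (i ∷ β) (j ∷ δ) (k ∷ γ)))))
      ≡⟨ conv-assoc a _ ⟩
    conv a (λ i m → conv m (λ j k → vconv α (λ β μ → vconv μ (λ δ γ → T (i ∷ β) (j ∷ δ) (k ∷ γ)))))
      ≡⟨ conv-cong a (λ i m _ → vconv-conv α m _) ⟨
    conv a (λ i m → vconv α (λ β μ → conv m (λ j k → vconv μ (λ δ γ → T (i ∷ β) (j ∷ δ) (k ∷ γ))))) ∎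

  -- Exponent vectors recurse at the head, whereas the variables are removed from the end. This is
  -- the bridge between the two, by exchange of sums.
  vconv-∷ʳ : ∀ {n} (α : Vec ℕ n) j T →
    vconv (α ∷ʳ j) T ≡ conv j (λ i k → vconv α (λ β γ → T (β ∷ʳ i) (γ ∷ʳ k)))
  vconv-∷ʳ []      j T = refl
  vconv-∷ʳ (a ∷ α) j T = trans (conv-cong a λ i k _ → vconv-∷ʳ α j _) (conv-conv a j _)

  sum-below : ∀ {n} (α : Vec ℕ n) T → sum (map (λ β → T β (α -v β)) (below α)) ≡ vconv α T
  sum-below []      T = +-identityʳ _
  sum-below (a ∷ α) T = begin
    sum (map G (concatMap (λ i → map (i ∷_) (below α)) (upTo (suc a))))
      ≡⟨ sum-concatMap G (λ i → map (i ∷_) (below α)) (upTo (suc a)) ⟩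
    sum (map (λ i → sum (map G (map (i ∷_) (below α)))) (upTo (suc a)))
      ≡⟨ cong sum (L.map-cong inner (upTo (suc a))) ⟩
    sum (map (λ i → vconv α (λ β γ → T (i ∷ β) ((a ∸ i) ∷ γ))) (upTo (suc a)))
      ≡⟨ sum-upTo a (λ i k → vconv α (λ β γ → T (i ∷ β) (k ∷ γ))) ⟩
    vconv (a ∷ α) T ∎
    where
    G : Vec ℕ _ → ℚ
    G β = T β ((a ∷ α) -v β)
    inner : ∀ i → sum (map G (map (i ∷_) (below α))) ≡ vconv α (λ β γ → T (i ∷ β) ((a ∸ i) ∷ γ))
    inner i = trans (cong sum (sym (L.map-∘ (below α))))
                    (sum-below α λ β γ → T (i ∷ β) ((a ∸ i) ∷ γ))

  -- Algebra of the Cauchy product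

  infix 4 _≈_
  _≈_ : ∀ {n} → PS n → PS n → Set
  f ≈ g = ∀ α → f α ≡ g α

  ⊛-vconv : ∀ {n} (f g : PS n) α → (f ⊛ g) α ≡ vconv α (λ β γ → f β * g γ)
  ⊛-vconv f g α = trans (⊛-def f g α) (sum-below α λ β γ → f β * g γ)

  ⊛-cong : ∀ {n} {f f′ g g′ : PS n} → f ≈ f′ → g ≈ g′ → (f ⊛ g) ≈ (f′ ⊛ g′)
  ⊛-cong {f = f} {f′} {g} {g′} p q α = begin
    (f ⊛ g) α                        ≡⟨ ⊛-vconv f g α ⟩
    vconv α (λ β γ → f β * g γ)      ≡⟨ vconv-cong′ α (λ β γ → cong₂ _*_ (p β) (q γ)) ⟩
    vconv α (λ β γ → f′ β * g′ γ)    ≡⟨ ⊛-vconv f′ g′ α ⟨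
    (f′ ⊛ g′) α                      ∎

  ⊛-congˡ : ∀ {n} (f : PS n) {g g′} → g ≈ g′ → (f ⊛ g) ≈ (f ⊛ g′)
  ⊛-congˡ f = ⊛-cong {f = f} λ _ → refl

  ⊛-congʳ : ∀ {n} {f f′} (g : PS n) → f ≈ f′ → (f ⊛ g) ≈ (f′ ⊛ g)
  ⊛-congʳ g e = ⊛-cong {g = g} e λ _ → refl

  ⊛-comm : ∀ {n} (f g : PS n) → (f ⊛ g) ≈ (g ⊛ f)
  ⊛-comm f g α = begin
    (f ⊛ g) α                      ≡⟨ ⊛-vconv f g α ⟩
    vconv α (λ β γ → f β * g γ)    ≡⟨ vconv-flip α _ ⟩
    vconv α (λ β γ → f γ * g β)    ≡⟨ vconv-cong′ α (λ β γ → *-comm (f γ) (g β)) ⟩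
    vconv α (λ β γ → g β * f γ)    ≡⟨ ⊛-vconv g f α ⟨
    (g ⊛ f) α                      ∎

  ⊛-assoc : ∀ {n} (f g h : PS n) → ((f ⊛ g) ⊛ h) ≈ (f ⊛ (g ⊛ h))
  ⊛-assoc f g h α = begin
    ((f ⊛ g) ⊛ h) α
      ≡⟨ ⊛-vconv (f ⊛ g) h α ⟩
    vconv α (λ μ γ → (f ⊛ g) μ * h γ)
      ≡⟨ vconv-cong′ α (λ μ γ → trans (*-comm _ (h γ)) (trans (cong (h γ *_) (⊛-vconv f g μ)) (sym (vconv-*ˡ μ (h γ) _)))) ⟩
    vconv α (λ μ γ → vconv μ (λ β δ → h γ * (f β * g δ)))
      ≡⟨ vconv-assoc α _ ⟩
    vconv α (λ β μ → vconv μ (λ δ γ → h γ * (f β * g δ)))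
      ≡⟨ vconv-cong′ α (λ β μ → trans (vconv-cong′ μ λ δ γ → rearrange (h γ) (f β) (g δ)) (vconv-*ˡ μ (f β) _)) ⟩
    vconv α (λ β μ → f β * vconv μ (λ δ γ → g δ * h γ))
      ≡⟨ vconv-cong′ α (λ β μ → cong (f β *_) (⊛-vconv g h μ)) ⟨
    vconv α (λ β μ → f β * (g ⊛ h) μ)
      ≡⟨ ⊛-vconv f (g ⊛ h) α ⟨
    (f ⊛ (g ⊛ h)) α ∎
    where
    rearrange : ∀ x y z → x * (y * z) ≡ y * (z * x)
    rearrange = solve 3 (λ x y z → x :* (y :* z) := y :* (z :* x)) refl

  ⊛-scaleˡ : ∀ {n} c (f g : PS n) → ((λ α → c * f α) ⊛ g) ≈ (λ α → c * (f ⊛ g) α)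
  ⊛-scaleˡ c f g α = begin
    ((λ β → c * f β) ⊛ g) α               ≡⟨ ⊛-vconv (λ β → c * f β) g α ⟩
    vconv α (λ β γ → (c * f β) * g γ)     ≡⟨ vconv-cong′ α (λ β γ → *-assoc c (f β) (g γ)) ⟩
    vconv α (λ β γ → c * (f β * g γ))     ≡⟨ vconv-*ˡ α c _ ⟩
    c * vconv α (λ β γ → f β * g γ)       ≡⟨ cong (c *_) (⊛-vconv f g α) ⟨
    c * (f ⊛ g) α                         ∎

  ⊛-scaleʳ : ∀ {n} c (f g : PS n) → (f ⊛ (λ α → c * g α)) ≈ (λ α → c * (f ⊛ g) α)
  ⊛-scaleʳ c f g α = begin
    (f ⊛ (λ β → c * g β)) α    ≡⟨ ⊛-comm f (λ β → c * g β) α ⟩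
    ((λ β → c * g β) ⊛ f) α    ≡⟨ ⊛-scaleˡ c g f α ⟩
    c * (g ⊛ f) α              ≡⟨ cong (c *_) (⊛-comm g f α) ⟩
    c * (f ⊛ g) α              ∎

  -- The common form of `oneS` and `X i`, each the indicator of a single exponent vector.
  δ : ∀ {n} → Vec ℕ n → PS n
  δ v α with ≡-dec ℕ._≟_ α v
  ... | yes _ = 1ℚ
  ... | no  _ = 0ℚ

  oneS-δ : ∀ {n} → oneS {n} ≈ δ zeroV
  oneS-δ α with ≡-dec ℕ._≟_ α zeroV
  ... | yes _ = refl
  ... | no  _ = refl

  X-δ : ∀ {n} i → X {n} i ≈ δ (unit i)
  X-δ i α with ≡-dec ℕ._≟_ α (unit i)
  ... | yes _ = refl
  ... | no  _ = refl

  δ-no : ∀ {n} (v α : Vec ℕ n) → α ≢ v → δ v α ≡ 0ℚ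
  δ-no v α ne with ≡-dec ℕ._≟_ α v
  ... | yes p = contradiction p ne
  ... | no  _ = refl

  δ-⇔ : ∀ {m n} (v α : Vec ℕ m) (w β : Vec ℕ n) →
    (α ≡ v → β ≡ w) → (β ≡ w → α ≡ v) → δ v α ≡ δ w β
  δ-⇔ v α w β to from with ≡-dec ℕ._≟_ α v | ≡-dec ℕ._≟_ β w
  ... | yes _ | yes _ = refl
  ... | yes p | no ¬q = contradiction (to p) ¬q
  ... | no ¬p | yes q = contradiction (from q) ¬p
  ... | no _  | no _  = refl

  δ-∷ʳ : ∀ {n} (v α : Vec ℕ n) k → δ (v ∷ʳ k) (α ∷ʳ k) ≡ δ v α
  δ-∷ʳ v α k = δ-⇔ (v ∷ʳ k) (α ∷ʳ k) v α (λ p → proj₁ (∷ʳ-injective α v p)) (cong (_∷ʳ k))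

  δ-∷ʳ-≢ : ∀ {n} (v α : Vec ℕ n) {k m} → m ≢ k → δ (v ∷ʳ k) (α ∷ʳ m) ≡ 0ℚ
  δ-∷ʳ-≢ v α {k} {m} ne = δ-no (v ∷ʳ k) (α ∷ʳ m) λ p → ne (proj₂ (∷ʳ-injective α v p))

  oneS-0∷ : ∀ {n} (α : Vec ℕ n) → oneS (0 ∷ α) ≡ oneS α
  oneS-0∷ α = trans (oneS-δ (0 ∷ α)) (trans
    (δ-⇔ zeroV (0 ∷ α) zeroV α (λ p → proj₂ (∷-injective p)) (cong (0 ∷_)))
    (sym (oneS-δ α)))

  oneS-suc∷ : ∀ {n} i (α : Vec ℕ n) → oneS (suc i ∷ α) ≡ 0ℚ
  oneS-suc∷ i α = trans (oneS-δ (suc i ∷ α)) (δ-no zeroV (suc i ∷ α) λ ())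

  ⊛-identityˡ : ∀ {n} (f : PS n) → (oneS ⊛ f) ≈ f
  ⊛-identityˡ f α = trans (⊛-vconv oneS f α) (go α f)
    where
    go : ∀ {n} (α : Vec ℕ n) (f : PS n) → vconv α (λ β γ → oneS β * f γ) ≡ f α
    go []      f = *-identityˡ _
    go (a ∷ α) f = begin
      conv a (λ i k → vconv α (λ β γ → oneS (i ∷ β) * f (k ∷ γ)))
        ≡⟨ conv-head a (λ i k → vconv-0 α λ β γ → trans (cong (_* f (k ∷ γ)) (oneS-suc∷ i β)) (zeroˡ (f (k ∷ γ)))) ⟩
      vconv α (λ β γ → oneS (0 ∷ β) * f (a ∷ γ))
        ≡⟨ vconv-cong′ α (λ β γ → cong (_* f (a ∷ γ)) (oneS-0∷ β)) ⟩
      vconv α (λ β γ → oneS β * f (a ∷ γ))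
        ≡⟨ go α (λ γ → f (a ∷ γ)) ⟩
      f (a ∷ α) ∎

  ⊛-identityʳ : ∀ {n} (f : PS n) → (f ⊛ oneS) ≈ f
  ⊛-identityʳ f α = trans (⊛-comm f oneS α) (⊛-identityˡ f α)

  -- Binomial coefficients

  interchange : ∀ w x y z → (w * x) * (y * z) ≡ (w * y) * (x * z)
  interchange = solve 4 (λ w x y z → (w :* x) :* (y :* z) := (w :* y) :* (x :* z)) refl

  ℕ→ℚ-+ : ∀ m n → ℕ→ℚ (m ℕ.+ n) ≡ ℕ→ℚ m + ℕ→ℚ n
  ℕ→ℚ-+ zero    n = sym (+-identityˡ _)
  ℕ→ℚ-+ (suc m) n = begin
    ℕ→ℚ (suc (m ℕ.+ n))        ≡⟨ ℕ→ℚ-suc (m ℕ.+ n) ⟩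
    1ℚ + ℕ→ℚ (m ℕ.+ n)         ≡⟨ cong (1ℚ +_) (ℕ→ℚ-+ m n) ⟩
    1ℚ + (ℕ→ℚ m + ℕ→ℚ n)       ≡⟨ +-assoc 1ℚ _ _ ⟨
    (1ℚ + ℕ→ℚ m) + ℕ→ℚ n       ≡⟨ cong (_+ ℕ→ℚ n) (ℕ→ℚ-suc m) ⟨
    ℕ→ℚ (suc m) + ℕ→ℚ n        ∎

  ℕ→ℚ-suc≢0 : ∀ n → ℕ→ℚ (suc n) ≢ 0ℚ
  ℕ→ℚ-suc≢0 n e = ℚP.<⇒≢ (ℚP.positive⁻¹ (ℕ→ℚ (suc n)) {{ℚP.normalize-pos (suc n) 1}}) (sym e)

  *-cancelˡ : ∀ {c x y} → c ≢ 0ℚ → c * x ≡ c * y → x ≡ y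
  *-cancelˡ {c} {x} {y} c≢0 e with ℚ-inverse c≢0
  ... | d , cd≡1 = begin
    x              ≡⟨ *-identityˡ x ⟨
    1ℚ * x         ≡⟨ cong (_* x) cd≡1 ⟨
    (c * d) * x    ≡⟨ swap c d x ⟩
    d * (c * x)    ≡⟨ cong (d *_) e ⟩
    d * (c * y)    ≡⟨ swap c d y ⟨
    (c * d) * y    ≡⟨ cong (_* y) cd≡1 ⟩
    1ℚ * y         ≡⟨ *-identityˡ y ⟩
    y              ∎
    where
    swap : ∀ c d x → (c * d) * x ≡ d * (c * x)
    swap = solve 3 (λ c d x → (c :* d) :* x := d :* (c :* x)) refl

  *-cancelʳ : ∀ {c x y} → c ≢ 0ℚ → x * c ≡ y * c → x ≡ y
  *-cancelʳ {c} {x} {y} c≢0 e = *-cancelˡ c≢0 (trans (*-comm c x) (trans e (*-comm y c)))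

  *-≢0 : ∀ {x y} → x ≢ 0ℚ → y ≢ 0ℚ → x * y ≢ 0ℚ
  *-≢0 {x} {y} x≢0 y≢0 e = y≢0 (*-cancelˡ x≢0 (trans e (sym (zeroʳ x))))

  sum-upTo-suc : ∀ f n → sum (map f (upTo (suc n))) ≡ sum (map f (upTo n)) + f n
  sum-upTo-suc f n = begin
    sum (map f (upTo (suc n)))             ≡⟨ cong (λ xs → sum (map f xs)) (L.upTo-∷ʳ n) ⟨
    sum (map f (upTo n ++ n ∷ []))         ≡⟨ cong sum (L.map-++ f (upTo n) (n ∷ [])) ⟩
    sum (map f (upTo n) ++ f n ∷ [])       ≡⟨ sum-++ (map f (upTo n)) (f n ∷ []) ⟩
    sum (map f (upTo n)) + (f n + 0ℚ)      ≡⟨ cong₂ _+_ refl (+-identityʳ (f n)) ⟩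
    sum (map f (upTo n)) + f n             ∎

  prod-++ : ∀ xs ys → prod (xs ++ ys) ≡ prod xs * prod ys
  prod-++ []       ys = sym (*-identityˡ _)
  prod-++ (x ∷ xs) ys = trans (cong (x *_) (prod-++ xs ys)) (sym (*-assoc x _ _))

  prod-upTo-suc : ∀ f n → prod (map f (upTo (suc n))) ≡ prod (map f (upTo n)) * f n
  prod-upTo-suc f n = begin
    prod (map f (upTo (suc n)))             ≡⟨ cong (λ xs → prod (map f xs)) (L.upTo-∷ʳ n) ⟨
    prod (map f (upTo n ++ n ∷ []))         ≡⟨ cong prod (L.map-++ f (upTo n) (n ∷ [])) ⟩
    prod (map f (upTo n) ++ f n ∷ [])       ≡⟨ prod-++ (map f (upTo n)) (f n ∷ []) ⟩
    prod (map f (upTo n)) * (f n * 1ℚ)      ≡⟨ cong₂ _*_ refl (*-identityʳ (f n)) ⟩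
    prod (map f (upTo n)) * f n             ∎

  poch-suc : ∀ x j → poch x (suc j) ≡ poch x j * (x + ℕ→ℚ j)
  poch-suc x j = begin
    poch x (suc j)                                          ≡⟨ poch-def x (suc j) ⟩
    prod (map (λ i → x + ℕ→ℚ i) (upTo (suc j)))             ≡⟨ prod-upTo-suc (λ i → x + ℕ→ℚ i) j ⟩
    prod (map (λ i → x + ℕ→ℚ i) (upTo j)) * (x + ℕ→ℚ j)     ≡⟨ cong (_* (x + ℕ→ℚ j)) (poch-def x j) ⟨
    poch x j * (x + ℕ→ℚ j)                                  ∎

  factℚ-suc : ∀ j → factℚ (suc j) ≡ factℚ j * ℕ→ℚ (suc j)
  factℚ-suc j = begin
    factℚ (suc j)                                            ≡⟨ factℚ-def (suc j) ⟩
    prod (map (λ i → ℕ→ℚ (suc i)) (upTo (suc j)))            ≡⟨ prod-upTo-suc (λ i → ℕ→ℚ (suc i)) j ⟩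
    prod (map (λ i → ℕ→ℚ (suc i)) (upTo j)) * ℕ→ℚ (suc j)    ≡⟨ cong (_* ℕ→ℚ (suc j)) (factℚ-def j) ⟨
    factℚ j * ℕ→ℚ (suc j)                                    ∎

  factℚ≢0 : ∀ j → factℚ j ≢ 0ℚ
  factℚ≢0 zero    = λ ()
  factℚ≢0 (suc j) e = *-≢0 (factℚ≢0 j) (ℕ→ℚ-suc≢0 j) (trans (sym (factℚ-suc j)) e)

  binomℚ-factℚ : ∀ a j → binomℚ a j * factℚ j ≡ prod (map (λ i → a + - ℕ→ℚ i) (upTo j))
  binomℚ-factℚ a j = trans (cong (_* factℚ j) (binomℚ-def a j)) (÷'-* (prod (map (λ i → a + - ℕ→ℚ i) (upTo j))) (factℚ≢0 j))

  binomℚ-suc : ∀ a j → ℕ→ℚ (suc j) * binomℚ a (suc j) ≡ (a + - ℕ→ℚ j) * binomℚ a j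
  binomℚ-suc a j = *-cancelʳ (factℚ≢0 j) (begin
    (ℕ→ℚ (suc j) * binomℚ a (suc j)) * factℚ j                        ≡⟨ rearrange (ℕ→ℚ (suc j)) (binomℚ a (suc j)) (factℚ j) ⟩
    binomℚ a (suc j) * (factℚ j * ℕ→ℚ (suc j))                        ≡⟨ cong (binomℚ a (suc j) *_) (factℚ-suc j) ⟨
    binomℚ a (suc j) * factℚ (suc j)                                  ≡⟨ binomℚ-factℚ a (suc j) ⟩
    prod (map (λ i → a + - ℕ→ℚ i) (upTo (suc j)))                     ≡⟨ prod-upTo-suc (λ i → a + - ℕ→ℚ i) j ⟩
    prod (map (λ i → a + - ℕ→ℚ i) (upTo j)) * (a + - ℕ→ℚ j)           ≡⟨ cong (_* (a + - ℕ→ℚ j)) (binomℚ-factℚ a j) ⟨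
    (binomℚ a j * factℚ j) * (a + - ℕ→ℚ j)                            ≡⟨ rearrange′ (binomℚ a j) (factℚ j) (a + - ℕ→ℚ j) ⟩
    ((a + - ℕ→ℚ j) * binomℚ a j) * factℚ j                            ∎)
    where
    rearrange : ∀ x y z → (x * y) * z ≡ y * (z * x)
    rearrange = solve 3 (λ x y z → (x :* y) :* z := y :* (z :* x)) refl
    rearrange′ : ∀ x y z → (x * y) * z ≡ (z * x) * y
    rearrange′ = solve 3 (λ x y z → (x :* y) :* z := (z :* x) :* y) refl

  -- Coefficient form of d/dt (1+t)^a = a (1+t)^(a-1). By `binomℚ-suc` both sides have the same
  -- ratio of consecutive terms, so induction applies once `j + 1` is cancelled.
  binomℚ-absorb : ∀ a j → ℕ→ℚ (suc j) * binomℚ a (suc j) ≡ a * binomℚ (a + - 1ℚ) j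
  binomℚ-absorb a zero    = trans (binomℚ-suc a 0) (cong (_* 1ℚ) (a-0 a))
    where
    a-0 : ∀ a → a + - 0ℚ ≡ a
    a-0 = solve 1 (λ a → a :+ :- con 0ℚ := a) refl
  binomℚ-absorb a (suc j) = *-cancelˡ (ℕ→ℚ-suc≢0 j) (begin
    ℕ→ℚ (suc j) * (ℕ→ℚ (suc (suc j)) * binomℚ a (suc (suc j)))   ≡⟨ cong (ℕ→ℚ (suc j) *_) (binomℚ-suc a (suc j)) ⟩
    ℕ→ℚ (suc j) * ((a + - ℕ→ℚ (suc j)) * binomℚ a (suc j))       ≡⟨ swap (ℕ→ℚ (suc j)) (a + - ℕ→ℚ (suc j)) (binomℚ a (suc j)) ⟩
    (a + - ℕ→ℚ (suc j)) * (ℕ→ℚ (suc j) * binomℚ a (suc j))       ≡⟨ cong₂ _*_ (cong (λ n → a + - n) (ℕ→ℚ-suc j)) (binomℚ-absorb a j) ⟩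
    (a + - (1ℚ + ℕ→ℚ j)) * (a * binomℚ (a + - 1ℚ) j)             ≡⟨ shift a (ℕ→ℚ j) (binomℚ (a + - 1ℚ) j) ⟩
    a * (((a + - 1ℚ) + - ℕ→ℚ j) * binomℚ (a + - 1ℚ) j)           ≡⟨ cong (a *_) (binomℚ-suc (a + - 1ℚ) j) ⟨
    a * (ℕ→ℚ (suc j) * binomℚ (a + - 1ℚ) (suc j))                ≡⟨ swap a (ℕ→ℚ (suc j)) (binomℚ (a + - 1ℚ) (suc j)) ⟩
    ℕ→ℚ (suc j) * (a * binomℚ (a + - 1ℚ) (suc j))                ∎)
    where
    swap : ∀ x y z → x * (y * z) ≡ y * (x * z)
    swap = solve 3 (λ x y z → x :* (y :* z) := y :* (x :* z)) refl
    shift : ∀ a j x → (a + - (1ℚ + j)) * (a * x) ≡ a * (((a + - 1ℚ) + - j) * x)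
    shift = solve 3 (λ a j x → (a :+ :- (con 1ℚ :+ j)) :* (a :* x) := a :* (((a :+ :- con 1ℚ) :+ :- j) :* x)) refl

  -- The product rule for d/dt of generating functions in t.
  conv-Leibniz : ∀ n T → ℕ→ℚ (suc n) * conv (suc n) T ≡
    conv n (λ i k → ℕ→ℚ (suc i) * T (suc i) k + ℕ→ℚ (suc k) * T i (suc k))
  conv-Leibniz n T = begin
    ℕ→ℚ (suc n) * conv (suc n) T
      ≡⟨ conv-*ˡ (suc n) (ℕ→ℚ (suc n)) T ⟨
    conv (suc n) (λ i k → ℕ→ℚ (suc n) * T i k)
      ≡⟨ conv-cong (suc n) (λ i k i+k≡n → trans (cong (_* T i k) (trans (cong ℕ→ℚ (sym i+k≡n)) (ℕ→ℚ-+ i k))) (distribʳ (T i k) (ℕ→ℚ i) (ℕ→ℚ k))) ⟩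
    conv (suc n) (λ i k → ℕ→ℚ i * T i k + ℕ→ℚ k * T i k)
      ≡⟨ conv-+ (suc n) (λ i k → ℕ→ℚ i * T i k) (λ i k → ℕ→ℚ k * T i k) ⟩
    conv (suc n) (λ i k → ℕ→ℚ i * T i k) + conv (suc n) (λ i k → ℕ→ℚ k * T i k)
      ≡⟨ cong₂ _+_ (trans (cong₂ _+_ (zeroˡ _) refl) (+-identityˡ _))
                   (trans (conv-last n (λ i k → ℕ→ℚ k * T i k)) (trans (cong₂ _+_ refl (zeroˡ _)) (+-identityʳ _))) ⟩
    conv n (λ i k → ℕ→ℚ (suc i) * T (suc i) k) + conv n (λ i k → ℕ→ℚ (suc k) * T i (suc k))
      ≡⟨ conv-+ n _ _ ⟨
    conv n (λ i k → ℕ→ℚ (suc i) * T (suc i) k + ℕ→ℚ (suc k) * T i (suc k)) ∎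

  -- Valid for rational exponents because both sides satisfy (n+1) f(n+1) = (a+c-n) f(n). In the
  -- Leibniz sum the two factors contribute a-i and c-k, and i + k = n makes their sum constant.
  vandermonde : ∀ a c n → conv n (λ i k → binomℚ a i * binomℚ c k) ≡ binomℚ (a + c) n
  vandermonde a c zero    = *-identityˡ 1ℚ
  vandermonde a c (suc n) = *-cancelˡ (ℕ→ℚ-suc≢0 n) (begin
    ℕ→ℚ (suc n) * conv (suc n) (λ i k → binomℚ a i * binomℚ c k)
      ≡⟨ conv-Leibniz n (λ i k → binomℚ a i * binomℚ c k) ⟩
    conv n (λ i k → ℕ→ℚ (suc i) * (binomℚ a (suc i) * binomℚ c k) + ℕ→ℚ (suc k) * (binomℚ a i * binomℚ c (suc k)))
      ≡⟨ conv-cong n term ⟩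
    conv n (λ i k → ((a + c) + - ℕ→ℚ n) * (binomℚ a i * binomℚ c k))
      ≡⟨ conv-*ˡ n ((a + c) + - ℕ→ℚ n) _ ⟩
    ((a + c) + - ℕ→ℚ n) * conv n (λ i k → binomℚ a i * binomℚ c k)
      ≡⟨ cong (((a + c) + - ℕ→ℚ n) *_) (vandermonde a c n) ⟩
    ((a + c) + - ℕ→ℚ n) * binomℚ (a + c) n
      ≡⟨ binomℚ-suc (a + c) n ⟨
    ℕ→ℚ (suc n) * binomℚ (a + c) (suc n) ∎)
    where
    group : ∀ i k x y x′ y′ → i * (x′ * y) + k * (x * y′) ≡ (i * x′) * y + x * (k * y′)
    group = solve 6 (λ i k x y x′ y′ → i :* (x′ :* y) :+ k :* (x :* y′) := (i :* x′) :* y :+ x :* (k :* y′)) refl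
    collect : ∀ a c i k x y → ((a + - i) * x) * y + x * ((c + - k) * y) ≡ ((a + c) + - (i + k)) * (x * y)
    collect = solve 6 (λ a c i k x y → ((a :+ :- i) :* x) :* y :+ x :* ((c :+ :- k) :* y)
                                       := ((a :+ c) :+ :- (i :+ k)) :* (x :* y)) refl
    term : ∀ i k → i ℕ.+ k ≡ n →
      ℕ→ℚ (suc i) * (binomℚ a (suc i) * binomℚ c k) + ℕ→ℚ (suc k) * (binomℚ a i * binomℚ c (suc k))
        ≡ ((a + c) + - ℕ→ℚ n) * (binomℚ a i * binomℚ c k)
    term i k i+k≡n = begin
      ℕ→ℚ (suc i) * (binomℚ a (suc i) * binomℚ c k) + ℕ→ℚ (suc k) * (binomℚ a i * binomℚ c (suc k))
        ≡⟨ group (ℕ→ℚ (suc i)) (ℕ→ℚ (suc k)) (binomℚ a i) (binomℚ c k) (binomℚ a (suc i)) (binomℚ c (suc k)) ⟩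
      (ℕ→ℚ (suc i) * binomℚ a (suc i)) * binomℚ c k + binomℚ a i * (ℕ→ℚ (suc k) * binomℚ c (suc k))
        ≡⟨ cong₂ (λ x y → x * binomℚ c k + binomℚ a i * y) (binomℚ-suc a i) (binomℚ-suc c k) ⟩
      ((a + - ℕ→ℚ i) * binomℚ a i) * binomℚ c k + binomℚ a i * ((c + - ℕ→ℚ k) * binomℚ c k)
        ≡⟨ collect a c (ℕ→ℚ i) (ℕ→ℚ k) (binomℚ a i) (binomℚ c k) ⟩
      ((a + c) + - (ℕ→ℚ i + ℕ→ℚ k)) * (binomℚ a i * binomℚ c k)
        ≡⟨ cong (λ m → ((a + c) + - m) * (binomℚ a i * binomℚ c k)) (trans (sym (ℕ→ℚ-+ i k)) (cong ℕ→ℚ i+k≡n)) ⟩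
      ((a + c) + - ℕ→ℚ n) * (binomℚ a i * binomℚ c k) ∎

  -- Powers of 1+L

  conv-truncate : ∀ d e (f : ℕ → ℚ) → (∀ m → d ℕ.< m → f m ≡ 0ℚ) →
    conv (d ℕ.+ e) (λ i _ → f i) ≡ conv d (λ i _ → f i)
  conv-truncate d zero    f f≡0 = cong (λ n → conv n (λ i _ → f i)) (ℕP.+-identityʳ d)
  conv-truncate d (suc e) f f≡0 = begin
    conv (d ℕ.+ suc e) (λ i _ → f i)                  ≡⟨ cong (λ n → conv n (λ i _ → f i)) (ℕP.+-suc d e) ⟩
    conv (suc (d ℕ.+ e)) (λ i _ → f i)                ≡⟨ conv-last (d ℕ.+ e) (λ i _ → f i) ⟩
    conv (d ℕ.+ e) (λ i _ → f i) + f (suc (d ℕ.+ e))  ≡⟨ cong₂ _+_ (conv-truncate d e f f≡0) (f≡0 (suc (d ℕ.+ e)) (ℕ.s≤s (ℕP.m≤m+n d e))) ⟩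
    conv d (λ i _ → f i) + 0ℚ                         ≡⟨ +-identityʳ _ ⟩
    conv d (λ i _ → f i)                              ∎

  -- The left side runs over the rectangle m ≤ d, k ≤ e, the right side over the larger triangle m +
  -- k ≤ d + e, and the additional terms vanish. The triangle is the shape that `conv-assoc` can
  -- regroup by m + k.
  conv-product : ∀ d e (p q : ℕ → ℚ) → (∀ m → d ℕ.< m → p m ≡ 0ℚ) → (∀ m → e ℕ.< m → q m ≡ 0ℚ) →
    conv d (λ i _ → p i) * conv e (λ k _ → q k) ≡ conv (d ℕ.+ e) (λ m r → conv r (λ k _ → p m * q k))
  conv-product d e p q p≡0 q≡0 = begin
    conv d (λ i _ → p i) * Q                             ≡⟨ cong (_* Q) (conv-truncate d e p p≡0) ⟨
    conv (d ℕ.+ e) (λ i _ → p i) * Q                     ≡⟨ *-comm _ Q ⟩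
    Q * conv (d ℕ.+ e) (λ i _ → p i)                     ≡⟨ conv-*ˡ (d ℕ.+ e) Q (λ i _ → p i) ⟨
    conv (d ℕ.+ e) (λ m _ → Q * p m)                     ≡⟨ conv-cong (d ℕ.+ e) term ⟩
    conv (d ℕ.+ e) (λ m r → conv r (λ k _ → p m * q k))  ∎
    where
    Q = conv e (λ k _ → q k)
    term : ∀ m r → m ℕ.+ r ≡ d ℕ.+ e → Q * p m ≡ conv r (λ k _ → p m * q k)
    term m r m+r≡d+e with m ℕP.≤? d
    ... | no  m≰d = begin
      Q * p m                     ≡⟨ cong (Q *_) (p≡0 m (ℕP.≰⇒> m≰d)) ⟩
      Q * 0ℚ                      ≡⟨ zeroʳ Q ⟩
      0ℚ                          ≡⟨ conv-0 r (λ k _ _ → trans (cong (_* q k) (p≡0 m (ℕP.≰⇒> m≰d))) (zeroˡ (q k))) ⟨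
      conv r (λ k _ → p m * q k)  ∎
    ... | yes m≤d = begin
      Q * p m                                       ≡⟨ *-comm Q (p m) ⟩
      p m * Q                                       ≡⟨ cong (p m *_) (conv-truncate e (d ∸ m) q q≡0) ⟨
      p m * conv (e ℕ.+ (d ∸ m)) (λ k _ → q k)      ≡⟨ cong (λ n → p m * conv n (λ k _ → q k)) r≡ ⟨
      p m * conv r (λ k _ → q k)                    ≡⟨ conv-*ˡ r (p m) (λ k _ → q k) ⟨
      conv r (λ k _ → p m * q k)                    ∎
      where
      r≡ : r ≡ e ℕ.+ (d ∸ m)
      r≡ = ℕP.+-cancelˡ-≡ m _ _ (trans m+r≡d+e (trans (cong (ℕ._+ e) (sym (ℕP.m+[n∸m]≡n m≤d))) (rearrange m (d ∸ m) e)))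
        where
        rearrange : ∀ x y z → (x ℕ.+ y) ℕ.+ z ≡ x ℕ.+ (z ℕ.+ y)
        rearrange = ℕR.solve-∀

  onePlusPow-conv : ∀ {n} a (L : PS n) α →
    onePlusPow a L α ≡ conv (deg α) (λ i _ → binomℚ a i * (L ^S i) α)
  onePlusPow-conv a L α = trans (onePlusPow-def a L α) (sum-upTo (deg α) (λ i _ → binomℚ a i * (L ^S i) α))

  ZeroConstantTerm : ∀ {n} → PS n → Set
  ZeroConstantTerm L = ∀ α → deg α ≡ 0 → L α ≡ 0ℚ

  -- This is why truncating (1+L)^a at the degree of the monomial loses nothing: each factor `L`
  -- uses up at least one degree.
  ^S-vanish : ∀ {n} {L : PS n} → ZeroConstantTerm L → ∀ m α → deg α ℕ.< m → (L ^S m) α ≡ 0ℚ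
  ^S-vanish {L = L} L₀ (suc m) α deg<m = begin
    (L ⊛ (L ^S m)) α                       ≡⟨ ⊛-vconv L (L ^S m) α ⟩
    vconv α (λ β γ → L β * (L ^S m) γ)     ≡⟨ vconv-cong α term ⟩
    vconv α (λ _ _ → 0ℚ)                   ≡⟨ vconv-0 α (λ _ _ → refl) ⟩
    0ℚ                                     ∎
    where
    term : ∀ β γ → deg β ℕ.+ deg γ ≡ deg α → L β * (L ^S m) γ ≡ 0ℚ
    term β γ e with deg β in eq
    ... | zero  = trans (cong (_* (L ^S m) γ) (L₀ β eq)) (zeroˡ _)
    ... | suc d = trans (cong (L β *_) (^S-vanish L₀ m γ (ℕP.≤-trans (ℕ.s≤s (ℕP.m≤n+m (deg γ) d)) (ℕP.≤-trans (ℕP.≤-reflexive e) (ℕP.≤-pred deg<m))))) (zeroʳ _)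

  ^S-+ : ∀ {n} (L : PS n) m k → ((L ^S m) ⊛ (L ^S k)) ≈ (L ^S (m ℕ.+ k))
  ^S-+ L zero    k α = ⊛-identityˡ (L ^S k) α
  ^S-+ L (suc m) k α = trans (⊛-assoc L (L ^S m) (L ^S k) α) (⊛-congˡ L (^S-+ L m k) α)

  -- The truncations at deg β and deg γ extend to the common triangle m + k ≤ deg α, which depends
  -- on `α` alone. The sums can then be exchanged, and grouping by s = m + k leaves Vandermonde's
  -- identity as the coefficient of L^s.
  onePlusPow-⊛ : ∀ {n} a c {L : PS n} → ZeroConstantTerm L →
    (onePlusPow a L ⊛ onePlusPow c L) ≈ onePlusPow (a + c) L
  onePlusPow-⊛ a c {L} L₀ α = begin
    (onePlusPow a L ⊛ onePlusPow c L) α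
      ≡⟨ ⊛-vconv (onePlusPow a L) (onePlusPow c L) α ⟩
    vconv α (λ β γ → onePlusPow a L β * onePlusPow c L γ)
      ≡⟨ vconv-cong α expand ⟩
    vconv α (λ β γ → conv D (λ m r → conv r (λ k _ → p m β * q k γ)))
      ≡⟨ vconv-conv α D (λ m r β γ → conv r (λ k _ → p m β * q k γ)) ⟩
    conv D (λ m r → vconv α (λ β γ → conv r (λ k _ → p m β * q k γ)))
      ≡⟨ conv-cong D (λ m r _ → vconv-conv α r (λ k _ β γ → p m β * q k γ)) ⟩
    conv D (λ m r → conv r (λ k _ → vconv α (λ β γ → p m β * q k γ)))
      ≡⟨ conv-cong D (λ m r _ → conv-cong r (λ k _ _ → multiply m k)) ⟩
    conv D (λ m r → conv r (λ k _ → (L ^S (m ℕ.+ k)) α * (binomℚ a m * binomℚ c k)))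
      ≡⟨ conv-assoc D (λ m k _ → (L ^S (m ℕ.+ k)) α * (binomℚ a m * binomℚ c k)) ⟨
    conv D (λ s _ → conv s (λ m k → (L ^S (m ℕ.+ k)) α * (binomℚ a m * binomℚ c k)))
      ≡⟨ conv-cong D (λ s _ _ → collect s) ⟩
    conv D (λ s _ → binomℚ (a + c) s * (L ^S s) α)
      ≡⟨ onePlusPow-conv (a + c) L α ⟨
    onePlusPow (a + c) L α ∎
    where
    D = deg α
    p q : ℕ → PS _
    p m β = binomℚ a m * (L ^S m) β
    q k γ = binomℚ c k * (L ^S k) γ
    expand : ∀ β γ → deg β ℕ.+ deg γ ≡ D →
      onePlusPow a L β * onePlusPow c L γ ≡ conv D (λ m r → conv r (λ k _ → p m β * q k γ))
    expand β γ e = begin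
      onePlusPow a L β * onePlusPow c L γ
        ≡⟨ cong₂ _*_ (onePlusPow-conv a L β) (onePlusPow-conv c L γ) ⟩
      conv (deg β) (λ m _ → p m β) * conv (deg γ) (λ k _ → q k γ)
        ≡⟨ conv-product (deg β) (deg γ) (λ m → p m β) (λ k → q k γ)
             (λ m d<m → trans (cong (binomℚ a m *_) (^S-vanish L₀ m β d<m)) (zeroʳ _))
             (λ k d<k → trans (cong (binomℚ c k *_) (^S-vanish L₀ k γ d<k)) (zeroʳ _)) ⟩
      conv (deg β ℕ.+ deg γ) (λ m r → conv r (λ k _ → p m β * q k γ))
        ≡⟨ cong (λ n → conv n (λ m r → conv r (λ k _ → p m β * q k γ))) e ⟩
      conv D (λ m r → conv r (λ k _ → p m β * q k γ)) ∎
    multiply : ∀ m k → vconv α (λ β γ → p m β * q k γ) ≡ (L ^S (m ℕ.+ k)) α * (binomℚ a m * binomℚ c k)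
    multiply m k = begin
      vconv α (λ β γ → p m β * q k γ)
        ≡⟨ vconv-cong′ α (λ β γ → interchange (binomℚ a m) ((L ^S m) β) (binomℚ c k) ((L ^S k) γ)) ⟩
      vconv α (λ β γ → (binomℚ a m * binomℚ c k) * ((L ^S m) β * (L ^S k) γ))
        ≡⟨ vconv-*ˡ α (binomℚ a m * binomℚ c k) (λ β γ → (L ^S m) β * (L ^S k) γ) ⟩
      (binomℚ a m * binomℚ c k) * vconv α (λ β γ → (L ^S m) β * (L ^S k) γ)
        ≡⟨ cong ((binomℚ a m * binomℚ c k) *_) (trans (sym (⊛-vconv (L ^S m) (L ^S k) α)) (^S-+ L m k α)) ⟩
      (binomℚ a m * binomℚ c k) * (L ^S (m ℕ.+ k)) α
        ≡⟨ *-comm _ ((L ^S (m ℕ.+ k)) α) ⟩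
      (L ^S (m ℕ.+ k)) α * (binomℚ a m * binomℚ c k) ∎
    collect : ∀ s → conv s (λ m k → (L ^S (m ℕ.+ k)) α * (binomℚ a m * binomℚ c k)) ≡ binomℚ (a + c) s * (L ^S s) α
    collect s = begin
      conv s (λ m k → (L ^S (m ℕ.+ k)) α * (binomℚ a m * binomℚ c k))
        ≡⟨ conv-cong s (λ m k e → cong (λ t → (L ^S t) α * (binomℚ a m * binomℚ c k)) e) ⟩
      conv s (λ m k → (L ^S s) α * (binomℚ a m * binomℚ c k))
        ≡⟨ conv-*ˡ s ((L ^S s) α) (λ m k → binomℚ a m * binomℚ c k) ⟩
      (L ^S s) α * conv s (λ m k → binomℚ a m * binomℚ c k)
        ≡⟨ cong ((L ^S s) α *_) (vandermonde a c s) ⟩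
      (L ^S s) α * binomℚ (a + c) s
        ≡⟨ *-comm _ (binomℚ (a + c) s) ⟩
      binomℚ (a + c) s * (L ^S s) α ∎

  -- Coefficients with respect to the last variable

  slice : ∀ {n} → PS (suc n) → ℕ → PS n
  slice g j α = g (α ∷ʳ j)

  slice-⊛ : ∀ {n} (f g : PS (suc n)) j α →
    slice (f ⊛ g) j α ≡ conv j (λ i k → (slice f i ⊛ slice g k) α)
  slice-⊛ f g j α = begin
    (f ⊛ g) (α ∷ʳ j)                                               ≡⟨ ⊛-vconv f g (α ∷ʳ j) ⟩
    vconv (α ∷ʳ j) (λ β γ → f β * g γ)                             ≡⟨ vconv-∷ʳ α j (λ β γ → f β * g γ) ⟩
    conv j (λ i k → vconv α (λ β γ → slice f i β * slice g k γ))   ≡⟨ conv-cong j (λ i k _ → ⊛-vconv (slice f i) (slice g k) α) ⟨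
    conv j (λ i k → (slice f i ⊛ slice g k) α)                     ∎

  ⊛-zeroˡ : ∀ {n} {f : PS n} (g : PS n) → (∀ α → f α ≡ 0ℚ) → ∀ α → (f ⊛ g) α ≡ 0ℚ
  ⊛-zeroˡ {f = f} g f≡0 α = trans (⊛-vconv f g α) (vconv-0 α λ β γ → trans (cong (_* g γ) (f≡0 β)) (zeroˡ (g γ)))

  oneS-∷ʳ-0 : ∀ {n} (α : Vec ℕ n) → oneS (α ∷ʳ 0) ≡ oneS α
  oneS-∷ʳ-0 []      = refl
  oneS-∷ʳ-0 (zero ∷ α)  = trans (oneS-0∷ (α ∷ʳ 0)) (trans (oneS-∷ʳ-0 α) (sym (oneS-0∷ α)))
  oneS-∷ʳ-0 (suc a ∷ α) = trans (oneS-suc∷ a (α ∷ʳ 0)) (sym (oneS-suc∷ a α))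

  oneS-∷ʳ-suc : ∀ {n} (α : Vec ℕ n) k → oneS (α ∷ʳ suc k) ≡ 0ℚ
  oneS-∷ʳ-suc []          k = oneS-suc∷ k []
  oneS-∷ʳ-suc (zero ∷ α)  k = trans (oneS-0∷ (α ∷ʳ suc k)) (oneS-∷ʳ-suc α k)
  oneS-∷ʳ-suc (suc a ∷ α) k = oneS-suc∷ a (α ∷ʳ suc k)

  deg-∷ʳ : ∀ {n} (α : Vec ℕ n) j → deg (α ∷ʳ j) ≡ deg α ℕ.+ j
  deg-∷ʳ []      j = ℕP.+-identityʳ j
  deg-∷ʳ (a ∷ α) j = trans (cong (a ℕ.+_) (deg-∷ʳ α j)) (sym (ℕP.+-assoc a (deg α) j))

  -- M = L + c x, where x is the last variable.
  record _≃_+_·x {n} (M : PS (suc n)) (L : PS n) (c : ℚ) : Set where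
    field
      slice-0  : slice M 0 ≈ L
      slice-1  : slice M 1 ≈ (λ α → c * oneS α)
      slice-2+ : ∀ k α → slice M (suc (suc k)) α ≡ 0ℚ

  module _ {n} {M : PS (suc n)} {L : PS n} {c} (M≃L+cx : M ≃ L + c ·x) where
    open _≃_+_·x M≃L+cx

    slice-⊛-0 : ∀ g α → slice (M ⊛ g) 0 α ≡ (L ⊛ slice g 0) α
    slice-⊛-0 g α = trans (slice-⊛ M g 0 α) (⊛-congʳ (slice g 0) slice-0 α)

    slice-⊛-suc : ∀ g j α → slice (M ⊛ g) (suc j) α ≡ (L ⊛ slice g (suc j)) α + c * slice g j α
    slice-⊛-suc g j α = begin
      slice (M ⊛ g) (suc j) α
        ≡⟨ slice-⊛ M g (suc j) α ⟩
      (slice M 0 ⊛ slice g (suc j)) α + conv j (λ i k → (slice M (suc i) ⊛ slice g k) α)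
        ≡⟨ cong₂ _+_ (⊛-congʳ (slice g (suc j)) slice-0 α)
                     (conv-head j λ i k → ⊛-zeroˡ (slice g k) (slice-2+ i) α) ⟩
      (L ⊛ slice g (suc j)) α + (slice M 1 ⊛ slice g j) α
        ≡⟨ cong₂ _+_ refl (⊛-congʳ (slice g j) slice-1 α) ⟩
      (L ⊛ slice g (suc j)) α + ((λ β → c * oneS β) ⊛ slice g j) α
        ≡⟨ cong₂ _+_ refl (trans (⊛-scaleˡ c oneS (slice g j) α) (cong (c *_) (⊛-identityˡ (slice g j) α))) ⟩
      (L ⊛ slice g (suc j)) α + c * slice g j α ∎

    slice-^S-0 : ∀ m → slice (M ^S m) 0 ≈ (L ^S m)
    slice-^S-0 zero    α = oneS-∷ʳ-0 α
    slice-^S-0 (suc m) α = trans (slice-⊛-0 (M ^S m) α) (⊛-congˡ L (slice-^S-0 m) α)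

    -- ∂ₓ M^(m+1) = (m+1) c M^m
    slice-^S-suc : ∀ m j α →
      ℕ→ℚ (suc j) * slice (M ^S suc m) (suc j) α ≡ ℕ→ℚ (suc m) * (c * slice (M ^S m) j α)
    slice-^S-suc zero zero α = begin
      1ℚ * slice (M ⊛ oneS) 1 α
        ≡⟨ cong (1ℚ *_) (trans (⊛-identityʳ M (α ∷ʳ 1)) (slice-1 α)) ⟩
      1ℚ * (c * oneS α)
        ≡⟨ cong (λ x → 1ℚ * (c * x)) (oneS-∷ʳ-0 α) ⟨
      1ℚ * (c * oneS (α ∷ʳ 0)) ∎
    slice-^S-suc zero (suc j) α = begin
      ℕ→ℚ (suc (suc j)) * slice (M ⊛ oneS) (suc (suc j)) α
        ≡⟨ cong (ℕ→ℚ (suc (suc j)) *_) (trans (⊛-identityʳ M (α ∷ʳ suc (suc j))) (slice-2+ j α)) ⟩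
      ℕ→ℚ (suc (suc j)) * 0ℚ
        ≡⟨ zeroes (ℕ→ℚ (suc (suc j))) c ⟩
      1ℚ * (c * 0ℚ)
        ≡⟨ cong (λ x → 1ℚ * (c * x)) (oneS-∷ʳ-suc α j) ⟨
      1ℚ * (c * oneS (α ∷ʳ suc j)) ∎
      where
      zeroes : ∀ x c → x * 0ℚ ≡ 1ℚ * (c * 0ℚ)
      zeroes = solve 2 (λ x c → x :* con 0ℚ := con 1ℚ :* (c :* con 0ℚ)) refl
    slice-^S-suc (suc m) j α = begin
      J * slice (M ^S suc (suc m)) (suc j) α
        ≡⟨ cong (J *_) (slice-⊛-suc (M ^S suc m) j α) ⟩
      J * ((L ⊛ slice (M ^S suc m) (suc j)) α + c * S)
        ≡⟨ distribˡ J _ _ ⟩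
      J * (L ⊛ slice (M ^S suc m) (suc j)) α + J * (c * S)
        ≡⟨ cong (_+ J * (c * S)) inner ⟩
      ℕ→ℚ (suc m) * (c * (L ⊛ slice (M ^S m) j) α) + J * (c * S)
        ≡⟨ finish j ⟩
      ℕ→ℚ (suc (suc m)) * (c * S) ∎
      where
      J = ℕ→ℚ (suc j)
      S = slice (M ^S suc m) j α
      inner : J * (L ⊛ slice (M ^S suc m) (suc j)) α ≡ ℕ→ℚ (suc m) * (c * (L ⊛ slice (M ^S m) j) α)
      inner = begin
        J * (L ⊛ slice (M ^S suc m) (suc j)) α
          ≡⟨ ⊛-scaleʳ J L (slice (M ^S suc m) (suc j)) α ⟨
        (L ⊛ (λ β → J * slice (M ^S suc m) (suc j) β)) α
          ≡⟨ ⊛-congˡ L (slice-^S-suc m j) α ⟩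
        (L ⊛ (λ β → ℕ→ℚ (suc m) * (c * slice (M ^S m) j β))) α
          ≡⟨ ⊛-scaleʳ (ℕ→ℚ (suc m)) L (λ β → c * slice (M ^S m) j β) α ⟩
        ℕ→ℚ (suc m) * (L ⊛ (λ β → c * slice (M ^S m) j β)) α
          ≡⟨ cong (ℕ→ℚ (suc m) *_) (⊛-scaleʳ c L (slice (M ^S m) j) α) ⟩
        ℕ→ℚ (suc m) * (c * (L ⊛ slice (M ^S m) j) α) ∎
      finish : ∀ j → ℕ→ℚ (suc m) * (c * (L ⊛ slice (M ^S m) j) α) + ℕ→ℚ (suc j) * (c * slice (M ^S suc m) j α)
                   ≡ ℕ→ℚ (suc (suc m)) * (c * slice (M ^S suc m) j α)
      finish zero = begin
        ℕ→ℚ (suc m) * (c * (L ⊛ slice (M ^S m) 0) α) + 1ℚ * (c * slice (M ^S suc m) 0 α)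
          ≡⟨ cong (λ x → ℕ→ℚ (suc m) * (c * x) + 1ℚ * (c * slice (M ^S suc m) 0 α)) (slice-⊛-0 (M ^S m) α) ⟨
        ℕ→ℚ (suc m) * (c * slice (M ^S suc m) 0 α) + 1ℚ * (c * slice (M ^S suc m) 0 α)
          ≡⟨ addOne (ℕ→ℚ (suc m)) (c * slice (M ^S suc m) 0 α) ⟩
        (1ℚ + ℕ→ℚ (suc m)) * (c * slice (M ^S suc m) 0 α)
          ≡⟨ cong (_* (c * slice (M ^S suc m) 0 α)) (ℕ→ℚ-suc (suc m)) ⟨
        ℕ→ℚ (suc (suc m)) * (c * slice (M ^S suc m) 0 α) ∎
        where
        addOne : ∀ m x → m * x + 1ℚ * x ≡ (1ℚ + m) * x
        addOne = solve 2 (λ m x → m :* x :+ con 1ℚ :* x := (con 1ℚ :+ m) :* x) refl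
      -- What has to be supplied is (i+1) B = (m+1) c C. This is the lemma itself for the same `m`
      -- at the lower index `i`, so the recursion is used a second time.
      finish (suc i) = begin
        μ * (c * A) + ℕ→ℚ (suc (suc i)) * (c * B)
          ≡⟨ cong₂ (λ x y → μ * (c * A) + x * (c * y)) (ℕ→ℚ-suc (suc i)) B≡ ⟩
        μ * (c * A) + (1ℚ + I) * (c * (A + c * C))
          ≡⟨ split μ I c A C ⟩
        (μ * (c * A) + 1ℚ * (c * (A + c * C))) + c * (I * (A + c * C))
          ≡⟨ cong (λ x → (μ * (c * A) + 1ℚ * (c * (A + c * C))) + c * x) (trans (cong (I *_) (sym B≡)) (slice-^S-suc m i α)) ⟩
        (μ * (c * A) + 1ℚ * (c * (A + c * C))) + c * (μ * (c * C))
          ≡⟨ merge μ c A C ⟩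
        (1ℚ + μ) * (c * (A + c * C))
          ≡⟨ cong₂ (λ x y → x * (c * y)) (ℕ→ℚ-suc (suc m)) B≡ ⟨
        ℕ→ℚ (suc (suc m)) * (c * B) ∎
        where
        μ = ℕ→ℚ (suc m)
        I = ℕ→ℚ (suc i)
        A = (L ⊛ slice (M ^S m) (suc i)) α
        B = slice (M ^S suc m) (suc i) α
        C = slice (M ^S m) i α
        B≡ : B ≡ A + c * C
        B≡ = slice-⊛-suc (M ^S m) i α
        split : ∀ μ I c A C → μ * (c * A) + (1ℚ + I) * (c * (A + c * C)) ≡
                              (μ * (c * A) + 1ℚ * (c * (A + c * C))) + c * (I * (A + c * C))
        split = solve 5 (λ μ I c A C → μ :* (c :* A) :+ (con 1ℚ :+ I) :* (c :* (A :+ c :* C)) :=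
                              (μ :* (c :* A) :+ con 1ℚ :* (c :* (A :+ c :* C))) :+ c :* (I :* (A :+ c :* C))) refl
        merge : ∀ μ c A C → (μ * (c * A) + 1ℚ * (c * (A + c * C))) + c * (μ * (c * C)) ≡ (1ℚ + μ) * (c * (A + c * C))
        merge = solve 4 (λ μ c A C → (μ :* (c :* A) :+ con 1ℚ :* (c :* (A :+ c :* C))) :+ c :* (μ :* (c :* C))
                                  := (con 1ℚ :+ μ) :* (c :* (A :+ c :* C))) refl

    slice-onePlusPow-0 : ∀ a α → slice (onePlusPow a M) 0 α ≡ onePlusPow a L α
    slice-onePlusPow-0 a α = begin
      onePlusPow a M (α ∷ʳ 0)
        ≡⟨ onePlusPow-conv a M (α ∷ʳ 0) ⟩
      conv (deg (α ∷ʳ 0)) (λ i _ → binomℚ a i * (M ^S i) (α ∷ʳ 0))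
        ≡⟨ cong (λ d → conv d (λ i _ → binomℚ a i * (M ^S i) (α ∷ʳ 0))) (trans (deg-∷ʳ α 0) (ℕP.+-identityʳ (deg α))) ⟩
      conv (deg α) (λ i _ → binomℚ a i * (M ^S i) (α ∷ʳ 0))
        ≡⟨ conv-cong (deg α) (λ i _ _ → cong (binomℚ a i *_) (slice-^S-0 i α)) ⟩
      conv (deg α) (λ i _ → binomℚ a i * (L ^S i) α)
        ≡⟨ onePlusPow-conv a L α ⟨
      onePlusPow a L α ∎

    -- ∂ₓ (1+M)^a = a c (1+M)^(a-1)
    slice-onePlusPow-suc : ∀ a j α →
      ℕ→ℚ (suc j) * slice (onePlusPow a M) (suc j) α ≡ (a * c) * slice (onePlusPow (a + - 1ℚ) M) j α
    slice-onePlusPow-suc a j α = begin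
      J * onePlusPow a M (α ∷ʳ suc j)
        ≡⟨ cong (J *_) (onePlusPow-conv a M (α ∷ʳ suc j)) ⟩
      J * conv (deg (α ∷ʳ suc j)) (λ i _ → binomℚ a i * (M ^S i) (α ∷ʳ suc j))
        -- One more power of x raises the truncation bound by one. Since the term L^0 has no x,
        -- dropping it and shifting the index makes the two bounds agree exactly.
        ≡⟨ cong (λ d → J * conv d (λ i _ → binomℚ a i * (M ^S i) (α ∷ʳ suc j))) deg≡ ⟩
      J * (binomℚ a 0 * oneS (α ∷ʳ suc j) + conv D (λ i _ → binomℚ a (suc i) * slice (M ^S suc i) (suc j) α))
        ≡⟨ cong (J *_) (trans (cong₂ _+_ (trans (cong (binomℚ a 0 *_) (oneS-∷ʳ-suc α j)) (zeroʳ _)) refl) (+-identityˡ _)) ⟩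
      J * conv D (λ i _ → binomℚ a (suc i) * slice (M ^S suc i) (suc j) α)
        ≡⟨ conv-*ˡ D J (λ i _ → binomℚ a (suc i) * slice (M ^S suc i) (suc j) α) ⟨
      conv D (λ i _ → J * (binomℚ a (suc i) * slice (M ^S suc i) (suc j) α))
        ≡⟨ conv-cong D (λ i _ _ → term i) ⟩
      conv D (λ i _ → (a * c) * (binomℚ (a + - 1ℚ) i * slice (M ^S i) j α))
        ≡⟨ conv-*ˡ D (a * c) (λ i _ → binomℚ (a + - 1ℚ) i * slice (M ^S i) j α) ⟩
      (a * c) * conv D (λ i _ → binomℚ (a + - 1ℚ) i * slice (M ^S i) j α)
        ≡⟨ cong ((a * c) *_) (onePlusPow-conv (a + - 1ℚ) M (α ∷ʳ j)) ⟨
      (a * c) * slice (onePlusPow (a + - 1ℚ) M) j α ∎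
      where
      J = ℕ→ℚ (suc j)
      D = deg (α ∷ʳ j)
      deg≡ : deg (α ∷ʳ suc j) ≡ suc D
      deg≡ = trans (deg-∷ʳ α (suc j)) (trans (ℕP.+-suc (deg α) j) (cong suc (sym (deg-∷ʳ α j))))
      swap : ∀ x y z → x * (y * z) ≡ y * (x * z)
      swap = solve 3 (λ x y z → x :* (y :* z) := y :* (x :* z)) refl
      group : ∀ x y z w → x * (y * (z * w)) ≡ (y * x) * (z * w)
      group = solve 4 (λ x y z w → x :* (y :* (z :* w)) := (y :* x) :* (z :* w)) refl
      term : ∀ i → J * (binomℚ a (suc i) * slice (M ^S suc i) (suc j) α) ≡ (a * c) * (binomℚ (a + - 1ℚ) i * slice (M ^S i) j α)
      term i = begin
        J * (binomℚ a (suc i) * slice (M ^S suc i) (suc j) α)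
          ≡⟨ swap J (binomℚ a (suc i)) _ ⟩
        binomℚ a (suc i) * (J * slice (M ^S suc i) (suc j) α)
          ≡⟨ cong (binomℚ a (suc i) *_) (slice-^S-suc i j α) ⟩
        binomℚ a (suc i) * (ℕ→ℚ (suc i) * (c * slice (M ^S i) j α))
          ≡⟨ group (binomℚ a (suc i)) (ℕ→ℚ (suc i)) c _ ⟩
        (ℕ→ℚ (suc i) * binomℚ a (suc i)) * (c * slice (M ^S i) j α)
          ≡⟨ cong (_* (c * slice (M ^S i) j α)) (binomℚ-absorb a i) ⟩
        (a * binomℚ (a + - 1ℚ) i) * (c * slice (M ^S i) j α)
          ≡⟨ interchange a (binomℚ (a + - 1ℚ) i) c _ ⟩
        (a * c) * (binomℚ (a + - 1ℚ) i * slice (M ^S i) j α) ∎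

    -- Taylor's formula in x at x = 0. The induction needs every `a` at once, since each derivative
    -- lowers the exponent along with `j`.
    slice-onePlusPow : ∀ a j → slice (onePlusPow a M) j ≈
      (λ α → (binomℚ a j * (c ^ℚ j)) * onePlusPow (a + - ℕ→ℚ j) L α)
    slice-onePlusPow a zero α = begin
      slice (onePlusPow a M) 0 α                         ≡⟨ slice-onePlusPow-0 a α ⟩
      onePlusPow a L α                                   ≡⟨ cong (λ x → onePlusPow x L α) (a-0 a) ⟨
      onePlusPow (a + - 0ℚ) L α                          ≡⟨ 1*1* (onePlusPow (a + - 0ℚ) L α) ⟨
      (1ℚ * 1ℚ) * onePlusPow (a + - 0ℚ) L α              ∎
      where
      a-0 : ∀ a → a + - 0ℚ ≡ a
      a-0 = solve 1 (λ a → a :+ :- con 0ℚ := a) refl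
      1*1* : ∀ x → (1ℚ * 1ℚ) * x ≡ x
      1*1* = solve 1 (λ x → (con 1ℚ :* con 1ℚ) :* x := x) refl
    slice-onePlusPow a (suc j) α = *-cancelˡ (ℕ→ℚ-suc≢0 j) (begin
      J * slice (onePlusPow a M) (suc j) α
        ≡⟨ slice-onePlusPow-suc a j α ⟩
      (a * c) * slice (onePlusPow (a + - 1ℚ) M) j α
        ≡⟨ cong ((a * c) *_) (slice-onePlusPow (a + - 1ℚ) j α) ⟩
      (a * c) * ((binomℚ (a + - 1ℚ) j * (c ^ℚ j)) * onePlusPow ((a + - 1ℚ) + - ℕ→ℚ j) L α)
        ≡⟨ cong (λ x → (a * c) * ((binomℚ (a + - 1ℚ) j * (c ^ℚ j)) * onePlusPow x L α)) exponent ⟩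
      (a * c) * ((binomℚ (a + - 1ℚ) j * (c ^ℚ j)) * P)
        ≡⟨ regroup a c (binomℚ (a + - 1ℚ) j) (c ^ℚ j) P ⟩
      ((a * binomℚ (a + - 1ℚ) j) * (c * (c ^ℚ j))) * P
        ≡⟨ cong₂ (λ x y → (x * y) * P) (binomℚ-absorb a j) (^ℚ-suc c j) ⟨
      ((J * binomℚ a (suc j)) * (c ^ℚ suc j)) * P
        ≡⟨ assoc J (binomℚ a (suc j)) (c ^ℚ suc j) P ⟩
      J * ((binomℚ a (suc j) * (c ^ℚ suc j)) * P) ∎)
      where
      J = ℕ→ℚ (suc j)
      P = onePlusPow (a + - ℕ→ℚ (suc j)) L α
      sub-sub : ∀ a j → (a + - 1ℚ) + - j ≡ a + - (1ℚ + j)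
      sub-sub = solve 2 (λ a j → (a :+ :- con 1ℚ) :+ :- j := a :+ :- (con 1ℚ :+ j)) refl
      exponent : (a + - 1ℚ) + - ℕ→ℚ j ≡ a + - ℕ→ℚ (suc j)
      exponent = trans (sub-sub a (ℕ→ℚ j)) (cong (λ x → a + - x) (sym (ℕ→ℚ-suc j)))
      regroup : ∀ a c x y z → (a * c) * ((x * y) * z) ≡ ((a * x) * (c * y)) * z
      regroup = solve 5 (λ a c x y z → (a :* c) :* ((x :* y) :* z) := ((a :* x) :* (c :* y)) :* z) refl
      assoc : ∀ w x y z → ((w * x) * y) * z ≡ w * ((x * y) * z)
      assoc = solve 4 (λ w x y z → ((w :* x) :* y) :* z := w :* ((x :* y) :* z)) refl

  -- The coefficient of yʲ in (1+2y)^b (1+y)^(-1-j)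

  two : ℚ
  two = 1ℚ + 1ℚ

  binomℚ-pascal : ∀ a j → binomℚ (a + 1ℚ) (suc j) ≡ binomℚ a (suc j) + binomℚ a j
  binomℚ-pascal a j = *-cancelˡ (ℕ→ℚ-suc≢0 j) (begin
    ℕ→ℚ (suc j) * binomℚ (a + 1ℚ) (suc j)
      ≡⟨ binomℚ-absorb (a + 1ℚ) j ⟩
    (a + 1ℚ) * binomℚ ((a + 1ℚ) + - 1ℚ) j
      ≡⟨ cong (λ x → (a + 1ℚ) * binomℚ x j) (add-sub a) ⟩
    (a + 1ℚ) * binomℚ a j
      ≡⟨ split a (ℕ→ℚ j) (binomℚ a j) ⟩
    (a + - ℕ→ℚ j) * binomℚ a j + (1ℚ + ℕ→ℚ j) * binomℚ a j
      ≡⟨ cong₂ (λ x y → x + y * binomℚ a j) (binomℚ-suc a j) (ℕ→ℚ-suc j) ⟨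
    ℕ→ℚ (suc j) * binomℚ a (suc j) + ℕ→ℚ (suc j) * binomℚ a j
      ≡⟨ distribˡ (ℕ→ℚ (suc j)) _ _ ⟨
    ℕ→ℚ (suc j) * (binomℚ a (suc j) + binomℚ a j) ∎)
    where
    add-sub : ∀ a → (a + 1ℚ) + - 1ℚ ≡ a
    add-sub = solve 1 (λ a → (a :+ con 1ℚ) :+ :- con 1ℚ := a) refl
    split : ∀ a j x → (a + 1ℚ) * x ≡ (a + - j) * x + (1ℚ + j) * x
    split = solve 3 (λ a j x → (a :+ con 1ℚ) :* x := (a :+ :- j) :* x :+ (con 1ℚ :+ j) :* x) refl

  -- The coefficients of (1+2y)^b.
  binomℚ₂ : ℚ → ℕ → ℚ
  binomℚ₂ b i = binomℚ b i * (two ^ℚ i)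

  binomℚ₂-suc : ∀ b i → ℕ→ℚ (suc i) * binomℚ₂ b (suc i) ≡ two * ((b + - ℕ→ℚ i) * binomℚ₂ b i)
  binomℚ₂-suc b i = begin
    ℕ→ℚ (suc i) * (binomℚ b (suc i) * (two ^ℚ suc i))
      ≡⟨ cong (λ x → ℕ→ℚ (suc i) * (binomℚ b (suc i) * x)) (^ℚ-suc two i) ⟩
    ℕ→ℚ (suc i) * (binomℚ b (suc i) * (two * (two ^ℚ i)))
      ≡⟨ regroup (ℕ→ℚ (suc i)) (binomℚ b (suc i)) two (two ^ℚ i) ⟩
    (ℕ→ℚ (suc i) * binomℚ b (suc i)) * (two * (two ^ℚ i))
      ≡⟨ cong (_* (two * (two ^ℚ i))) (binomℚ-suc b i) ⟩
    ((b + - ℕ→ℚ i) * binomℚ b i) * (two * (two ^ℚ i))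
      ≡⟨ regroup′ (b + - ℕ→ℚ i) (binomℚ b i) two (two ^ℚ i) ⟩
    two * ((b + - ℕ→ℚ i) * binomℚ₂ b i) ∎
    where
    regroup : ∀ w x y z → w * (x * (y * z)) ≡ (w * x) * (y * z)
    regroup = solve 4 (λ w x y z → w :* (x :* (y :* z)) := (w :* x) :* (y :* z)) refl
    regroup′ : ∀ w x y z → (w * x) * (y * z) ≡ y * (w * (x * z))
    regroup′ = solve 4 (λ w x y z → (w :* x) :* (y :* z) := y :* (w :* (x :* z))) refl

  -- H b κ n = [yⁿ] (1+2y)^b (1+y)^κ and K b κ n = [yⁿ] y(∂(1+2y)^b)(1+y)^κ.
  H K : ℚ → ℚ → ℕ → ℚ
  H b κ n = conv n (λ i k → binomℚ₂ b i * binomℚ κ k)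
  K b κ n = conv n (λ i k → ℕ→ℚ i * (binomℚ₂ b i * binomℚ κ k))

  -- In the Leibniz sum a term gets the weight 2(b-i) + (κ-k) = (2b+κ-n) - i. The surplus i, due to
  -- the factor 2 in 1+2y, is what `K` collects.
  H-suc : ∀ b κ n →
    ℕ→ℚ (suc n) * H b κ (suc n) ≡ (two * b + κ + - ℕ→ℚ n) * H b κ n + - K b κ n
  H-suc b κ n = begin
    ℕ→ℚ (suc n) * H b κ (suc n)
      ≡⟨ conv-Leibniz n (λ i k → binomℚ₂ b i * binomℚ κ k) ⟩
    conv n (λ i k → ℕ→ℚ (suc i) * (binomℚ₂ b (suc i) * binomℚ κ k) + ℕ→ℚ (suc k) * (binomℚ₂ b i * binomℚ κ (suc k)))
      ≡⟨ conv-cong n term ⟩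
    conv n (λ i k → A * (binomℚ₂ b i * binomℚ κ k) + (- 1ℚ) * (ℕ→ℚ i * (binomℚ₂ b i * binomℚ κ k)))
      ≡⟨ conv-+ n (λ i k → A * (binomℚ₂ b i * binomℚ κ k)) (λ i k → (- 1ℚ) * (ℕ→ℚ i * (binomℚ₂ b i * binomℚ κ k))) ⟩
    conv n (λ i k → A * (binomℚ₂ b i * binomℚ κ k)) + conv n (λ i k → (- 1ℚ) * (ℕ→ℚ i * (binomℚ₂ b i * binomℚ κ k)))
      ≡⟨ cong₂ _+_ (conv-*ˡ n A (λ i k → binomℚ₂ b i * binomℚ κ k)) (conv-*ˡ n (- 1ℚ) (λ i k → ℕ→ℚ i * (binomℚ₂ b i * binomℚ κ k))) ⟩
    A * H b κ n + (- 1ℚ) * K b κ n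
      ≡⟨ cong₂ _+_ refl (neg (K b κ n)) ⟩
    A * H b κ n + - K b κ n ∎
    where
    A = two * b + κ + - ℕ→ℚ n
    neg : ∀ x → (- 1ℚ) * x ≡ - x
    neg = solve 1 (λ x → (:- con 1ℚ) :* x := :- x) refl
    group : ∀ i k x y x′ y′ → i * (x′ * y) + k * (x * y′) ≡ (i * x′) * y + x * (k * y′)
    group = solve 6 (λ i k x y x′ y′ → i :* (x′ :* y) :+ k :* (x :* y′) := (i :* x′) :* y :+ x :* (k :* y′)) refl
    collect : ∀ b κ i k x y → (two * ((b + - i) * x)) * y + x * ((κ + - k) * y) ≡
      (two * b + κ + - (i + k)) * (x * y) + (- 1ℚ) * (i * (x * y))
    collect = solve 6 (λ b κ i k x y → ((con 1ℚ :+ con 1ℚ) :* ((b :+ :- i) :* x)) :* y :+ x :* ((κ :+ :- k) :* y) :=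
      ((con 1ℚ :+ con 1ℚ) :* b :+ κ :+ :- (i :+ k)) :* (x :* y) :+ (:- con 1ℚ) :* (i :* (x :* y))) refl
    term : ∀ i k → i ℕ.+ k ≡ n →
      ℕ→ℚ (suc i) * (binomℚ₂ b (suc i) * binomℚ κ k) + ℕ→ℚ (suc k) * (binomℚ₂ b i * binomℚ κ (suc k))
        ≡ A * (binomℚ₂ b i * binomℚ κ k) + (- 1ℚ) * (ℕ→ℚ i * (binomℚ₂ b i * binomℚ κ k))
    term i k i+k≡n = begin
      ℕ→ℚ (suc i) * (binomℚ₂ b (suc i) * binomℚ κ k) + ℕ→ℚ (suc k) * (binomℚ₂ b i * binomℚ κ (suc k))
        ≡⟨ group (ℕ→ℚ (suc i)) (ℕ→ℚ (suc k)) (binomℚ₂ b i) (binomℚ κ k) (binomℚ₂ b (suc i)) (binomℚ κ (suc k)) ⟩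
      (ℕ→ℚ (suc i) * binomℚ₂ b (suc i)) * binomℚ κ k + binomℚ₂ b i * (ℕ→ℚ (suc k) * binomℚ κ (suc k))
        ≡⟨ cong₂ (λ x y → x * binomℚ κ k + binomℚ₂ b i * y) (binomℚ₂-suc b i) (binomℚ-suc κ k) ⟩
      (two * ((b + - ℕ→ℚ i) * binomℚ₂ b i)) * binomℚ κ k + binomℚ₂ b i * ((κ + - ℕ→ℚ k) * binomℚ κ k)
        ≡⟨ collect b κ (ℕ→ℚ i) (ℕ→ℚ k) (binomℚ₂ b i) (binomℚ κ k) ⟩
      (two * b + κ + - (ℕ→ℚ i + ℕ→ℚ k)) * (binomℚ₂ b i * binomℚ κ k) + (- 1ℚ) * (ℕ→ℚ i * (binomℚ₂ b i * binomℚ κ k))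
        ≡⟨ cong (λ m → (two * b + κ + - m) * (binomℚ₂ b i * binomℚ κ k) + (- 1ℚ) * (ℕ→ℚ i * (binomℚ₂ b i * binomℚ κ k)))
                (trans (sym (ℕ→ℚ-+ i k)) (cong ℕ→ℚ i+k≡n)) ⟩
      A * (binomℚ₂ b i * binomℚ κ k) + (- 1ℚ) * (ℕ→ℚ i * (binomℚ₂ b i * binomℚ κ k)) ∎

  -- From (1+2y) ∂(1+2y)^b = 2b (1+2y)^b. Together with `H-suc` it makes the recurrences for `H` and
  -- `K` a closed system at fixed `κ`.
  K-suc : ∀ b κ n → K b κ (suc n) ≡ (two * b) * H b κ n + (- two) * K b κ n
  K-suc b κ n = begin
    0ℚ * (binomℚ₂ b 0 * binomℚ κ (suc n)) + conv n (λ i k → ℕ→ℚ (suc i) * (binomℚ₂ b (suc i) * binomℚ κ k))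
      ≡⟨ trans (cong₂ _+_ (zeroˡ _) refl) (+-identityˡ _) ⟩
    conv n (λ i k → ℕ→ℚ (suc i) * (binomℚ₂ b (suc i) * binomℚ κ k))
      ≡⟨ conv-cong n (λ i k _ → term i k) ⟩
    conv n (λ i k → (two * b) * (binomℚ₂ b i * binomℚ κ k) + (- two) * (ℕ→ℚ i * (binomℚ₂ b i * binomℚ κ k)))
      ≡⟨ conv-+ n (λ i k → (two * b) * (binomℚ₂ b i * binomℚ κ k)) (λ i k → (- two) * (ℕ→ℚ i * (binomℚ₂ b i * binomℚ κ k))) ⟩
    conv n (λ i k → (two * b) * (binomℚ₂ b i * binomℚ κ k)) + conv n (λ i k → (- two) * (ℕ→ℚ i * (binomℚ₂ b i * binomℚ κ k)))
      ≡⟨ cong₂ _+_ (conv-*ˡ n (two * b) (λ i k → binomℚ₂ b i * binomℚ κ k)) (conv-*ˡ n (- two) (λ i k → ℕ→ℚ i * (binomℚ₂ b i * binomℚ κ k))) ⟩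
    (two * b) * H b κ n + (- two) * K b κ n ∎
    where
    expand : ∀ b i x y → (two * ((b + - i) * x)) * y ≡ (two * b) * (x * y) + (- two) * (i * (x * y))
    expand = solve 4 (λ b i x y → ((con 1ℚ :+ con 1ℚ) :* ((b :+ :- i) :* x)) :* y :=
      ((con 1ℚ :+ con 1ℚ) :* b) :* (x :* y) :+ (:- (con 1ℚ :+ con 1ℚ)) :* (i :* (x :* y))) refl
    term : ∀ i k → ℕ→ℚ (suc i) * (binomℚ₂ b (suc i) * binomℚ κ k) ≡
      (two * b) * (binomℚ₂ b i * binomℚ κ k) + (- two) * (ℕ→ℚ i * (binomℚ₂ b i * binomℚ κ k))
    term i k = trans (sym (*-assoc (ℕ→ℚ (suc i)) _ _))
      (trans (cong (_* binomℚ κ k) (binomℚ₂-suc b i)) (expand b (ℕ→ℚ i) (binomℚ₂ b i) (binomℚ κ k)))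

  -- Multiplication of the series by 1+y: this is the means of changing the exponent `κ`.
  H-pascal : ∀ b κ n → H b (κ + 1ℚ) (suc n) ≡ H b κ (suc n) + H b κ n
  H-pascal b κ n = begin
    H b (κ + 1ℚ) (suc n)
      ≡⟨ conv-last n (λ i k → binomℚ₂ b i * binomℚ (κ + 1ℚ) k) ⟩
    conv n (λ i k → binomℚ₂ b i * binomℚ (κ + 1ℚ) (suc k)) + last
      ≡⟨ cong (_+ last) (conv-cong n λ i k _ → trans (cong (binomℚ₂ b i *_) (binomℚ-pascal κ k)) (distribˡ (binomℚ₂ b i) _ _)) ⟩
    conv n (λ i k → binomℚ₂ b i * binomℚ κ (suc k) + binomℚ₂ b i * binomℚ κ k) + last
      ≡⟨ cong (_+ last) (conv-+ n (λ i k → binomℚ₂ b i * binomℚ κ (suc k)) (λ i k → binomℚ₂ b i * binomℚ κ k)) ⟩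
    (conv n (λ i k → binomℚ₂ b i * binomℚ κ (suc k)) + H b κ n) + last
      ≡⟨ swap _ (H b κ n) last ⟩
    (conv n (λ i k → binomℚ₂ b i * binomℚ κ (suc k)) + last) + H b κ n
      ≡⟨ cong (_+ H b κ n) (conv-last n (λ i k → binomℚ₂ b i * binomℚ κ k)) ⟨
    H b κ (suc n) + H b κ n ∎
    where
    last = binomℚ₂ b (suc n) * 1ℚ
    swap : ∀ x y z → (x + y) + z ≡ (x + z) + y
    swap = solve 3 (λ x y z → (x :+ y) :+ z := (x :+ z) :+ y) refl

  -- Eliminating `K` at fixed κ gives (n+1) H(n+1) = (2b+κ-3n) H(n) + (2b+2κ-2n+2) H(n-1). The two
  -- coefficients on the right coincide exactly when κ = -(n+2), and then `H-pascal` merges H(n) +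
  -- H(n-1) into the single value with exponent κ+1.
  diagonal-H-suc : ∀ b n → ℕ→ℚ (suc n) * H b (- ℕ→ℚ (suc (suc n))) (suc n) ≡
    (two * (b + - 1ℚ + - (two * ℕ→ℚ n))) * H b (- ℕ→ℚ (suc n)) n
  diagonal-H-suc b zero = begin
    -- Here there is no term of index n-1, and `K b κ 0` is zero, so `H-suc` alone suffices.
    1ℚ * H b (- ℕ→ℚ 2) 1
      ≡⟨ H-suc b (- ℕ→ℚ 2) 0 ⟩
    (two * b + - ℕ→ℚ 2 + - 0ℚ) * (binomℚ₂ b 0 * 1ℚ) + - (0ℚ * (binomℚ₂ b 0 * 1ℚ))
      ≡⟨ cong (λ x → (two * b + - x + - 0ℚ) * (binomℚ₂ b 0 * 1ℚ) + - (0ℚ * (binomℚ₂ b 0 * 1ℚ))) (ℕ→ℚ-suc 1) ⟩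
    (two * b + - two + - 0ℚ) * (binomℚ₂ b 0 * 1ℚ) + - (0ℚ * (binomℚ₂ b 0 * 1ℚ))
      ≡⟨ simplify b (binomℚ₂ b 0 * 1ℚ) ⟩
    (two * (b + - 1ℚ + - (two * 0ℚ))) * (binomℚ₂ b 0 * 1ℚ) ∎
    where
    simplify : ∀ b x → (two * b + - two + - 0ℚ) * x + - (0ℚ * x) ≡ (two * (b + - 1ℚ + - (two * 0ℚ))) * x
    simplify = solve 2 (λ b x → ((con 1ℚ :+ con 1ℚ) :* b :+ :- (con 1ℚ :+ con 1ℚ) :+ :- con 0ℚ) :* x :+ :- (con 0ℚ :* x) :=
      ((con 1ℚ :+ con 1ℚ) :* (b :+ :- con 1ℚ :+ :- ((con 1ℚ :+ con 1ℚ) :* con 0ℚ))) :* x) refl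
  diagonal-H-suc b (suc m) = begin
    ℕ→ℚ (suc (suc m)) * H b κ (suc (suc m))
      ≡⟨ H-suc b κ (suc m) ⟩
    (two * b + κ + - ℕ→ℚ (suc m)) * H b κ (suc m) + - K b κ (suc m)
      ≡⟨ cong (λ x → (two * b + κ + - ℕ→ℚ (suc m)) * H b κ (suc m) + - x) (K-suc b κ m) ⟩
    (two * b + κ + - ℕ→ℚ (suc m)) * H b κ (suc m) + - ((two * b) * H b κ m + (- two) * K b κ m)
      ≡⟨ cong (λ x → (two * b + κ + - ℕ→ℚ (suc m)) * H b κ (suc m) + - ((two * b) * H b κ m + (- two) * x)) K≡ ⟩
    (two * b + κ + - ℕ→ℚ (suc m)) * H b κ (suc m) + - ((two * b) * H b κ m + (- two) * ((two * b + κ + - ℕ→ℚ m) * H b κ m + - (ℕ→ℚ (suc m) * H b κ (suc m))))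
      ≡⟨ cong₂ (λ κ M → (two * b + κ + - M) * h′ + - ((two * b) * h + (- two) * ((two * b + κ + - ℕ→ℚ m) * h + - (M * h′)))) κ≡ (ℕ→ℚ-suc m) ⟩
    (two * b + κ₀ + - (1ℚ + ℕ→ℚ m)) * h′ + - ((two * b) * h + (- two) * ((two * b + κ₀ + - ℕ→ℚ m) * h + - ((1ℚ + ℕ→ℚ m) * h′)))
      ≡⟨ simplify b (ℕ→ℚ m) h h′ ⟩
    (two * (b + - 1ℚ + - (two * (1ℚ + ℕ→ℚ m)))) * (h′ + h)
      ≡⟨ cong₂ (λ x y → (two * (b + - 1ℚ + - (two * x))) * y) (ℕ→ℚ-suc m) pascal ⟨
    (two * (b + - 1ℚ + - (two * ℕ→ℚ (suc m)))) * H b (- ℕ→ℚ (suc (suc m))) (suc m) ∎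
    where
    κ = - ℕ→ℚ (suc (suc (suc m)))
    κ₀ = - (1ℚ + (1ℚ + (1ℚ + ℕ→ℚ m)))
    h = H b κ m
    h′ = H b κ (suc m)
    suc≡ : ℕ→ℚ (suc (suc m)) ≡ 1ℚ + (1ℚ + ℕ→ℚ m)
    suc≡ = trans (ℕ→ℚ-suc (suc m)) (cong (1ℚ +_) (ℕ→ℚ-suc m))
    κ≡ : κ ≡ κ₀
    κ≡ = cong -_ (trans (ℕ→ℚ-suc (suc (suc m))) (cong (1ℚ +_) suc≡))
    cancel : ∀ x y → y ≡ x + - (x + - y)
    cancel = solve 2 (λ x y → y := x :+ :- (x :+ :- y)) refl
    -- `H-suc` solved for `K`, so that only values of `H` remain.
    K≡ : K b κ m ≡ (two * b + κ + - ℕ→ℚ m) * H b κ m + - (ℕ→ℚ (suc m) * H b κ (suc m))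
    K≡ = trans (cancel ((two * b + κ + - ℕ→ℚ m) * H b κ m) (K b κ m)) (cong (λ x → (two * b + κ + - ℕ→ℚ m) * H b κ m + - x) (sym (H-suc b κ m)))
    neg-suc : ∀ x → - x ≡ - (1ℚ + x) + 1ℚ
    neg-suc = solve 1 (λ x → :- x := :- (con 1ℚ :+ x) :+ con 1ℚ) refl
    pascal : H b (- ℕ→ℚ (suc (suc m))) (suc m) ≡ h′ + h
    pascal = trans (cong (λ x → H b x (suc m)) (trans (neg-suc (ℕ→ℚ (suc (suc m)))) (cong (λ x → - x + 1ℚ) (sym (ℕ→ℚ-suc (suc (suc m))))))) (H-pascal b κ m)
    simplify : ∀ b m h h′ →
      (two * b + - (1ℚ + (1ℚ + (1ℚ + m))) + - (1ℚ + m)) * h′ + - ((two * b) * h + (- two) * ((two * b + - (1ℚ + (1ℚ + (1ℚ + m))) + - m) * h + - ((1ℚ + m) * h′)))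
      ≡ (two * (b + - 1ℚ + - (two * (1ℚ + m)))) * (h′ + h)
    simplify = solve 4 (λ b m h h′ → let one = con 1ℚ ; two = one :+ one ; κ = :- (one :+ (one :+ (one :+ m))) in
      (two :* b :+ κ :+ :- (one :+ m)) :* h′ :+ :- ((two :* b) :* h :+ (:- two) :* ((two :* b :+ κ :+ :- m) :* h :+ :- ((one :+ m) :* h′)))
      := (two :* (b :+ :- one :+ :- (two :* (one :+ m)))) :* (h′ :+ h)) refl

  -- The factor 2(b-1-2j) of the recurrence equals -4(h+j) for h = (1-b)/2, so iteration builds a
  -- Pochhammer symbol in `h`. This is the origin of the parameter u^(N-1).
  diagonal-H : ∀ b {h} → h + h ≡ 1ℚ + - b → ∀ j →
    H b (- ℕ→ℚ (suc j)) j * factℚ j ≡ (((- 1ℚ) ^ℚ j) * ((two * two) ^ℚ j)) * poch h j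
  diagonal-H b {h} h+h≡1-b zero = *-identityʳ ((1ℚ * 1ℚ) * 1ℚ)
  diagonal-H b {h} h+h≡1-b (suc j) = begin
    H b (- ℕ→ℚ (suc (suc j))) (suc j) * factℚ (suc j)
      ≡⟨ cong (H b (- ℕ→ℚ (suc (suc j))) (suc j) *_) (factℚ-suc j) ⟩
    H b (- ℕ→ℚ (suc (suc j))) (suc j) * (factℚ j * ℕ→ℚ (suc j))
      ≡⟨ rotate _ (factℚ j) (ℕ→ℚ (suc j)) ⟩
    (ℕ→ℚ (suc j) * H b (- ℕ→ℚ (suc (suc j))) (suc j)) * factℚ j
      ≡⟨ cong (_* factℚ j) (diagonal-H-suc b j) ⟩
    ((two * (b + - 1ℚ + - (two * ℕ→ℚ j))) * H b (- ℕ→ℚ (suc j)) j) * factℚ j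
      ≡⟨ *-assoc _ _ (factℚ j) ⟩
    (two * (b + - 1ℚ + - (two * ℕ→ℚ j))) * (H b (- ℕ→ℚ (suc j)) j * factℚ j)
      ≡⟨ cong₂ _*_ factor (diagonal-H b h+h≡1-b j) ⟩
    (- 1ℚ * (two * two) * (h + ℕ→ℚ j)) * ((((- 1ℚ) ^ℚ j) * ((two * two) ^ℚ j)) * poch h j)
      ≡⟨ regroup (- 1ℚ) (two * two) (h + ℕ→ℚ j) _ _ _ ⟩
    ((- 1ℚ * ((- 1ℚ) ^ℚ j)) * ((two * two) * ((two * two) ^ℚ j))) * (poch h j * (h + ℕ→ℚ j))
      ≡⟨ cong₂ _*_ (cong₂ _*_ (^ℚ-suc (- 1ℚ) j) (^ℚ-suc (two * two) j)) (poch-suc h j) ⟨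
    (((- 1ℚ) ^ℚ suc j) * ((two * two) ^ℚ suc j)) * poch h (suc j) ∎
    where
    rotate : ∀ x y z → x * (y * z) ≡ (z * x) * y
    rotate = solve 3 (λ x y z → x :* (y :* z) := (z :* x) :* y) refl
    regroup : ∀ s f q x y z → (s * f * q) * ((x * y) * z) ≡ ((s * x) * (f * y)) * (z * q)
    regroup = solve 6 (λ s f q x y z → (s :* f :* q) :* ((x :* y) :* z) := ((s :* x) :* (f :* y)) :* (z :* q)) refl
    expand : ∀ b j → two * (b + - 1ℚ + - (two * j)) ≡ - two * ((1ℚ + - b) + two * j)
    expand = solve 2 (λ b j → let one = con 1ℚ ; two = one :+ one in
      two :* (b :+ :- one :+ :- (two :* j)) := (:- two) :* ((one :+ :- b) :+ two :* j)) refl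
    refold : ∀ h j → - two * ((h + h) + two * j) ≡ - 1ℚ * (two * two) * (h + j)
    refold = solve 2 (λ h j → let one = con 1ℚ ; two = one :+ one in
      (:- two) :* ((h :+ h) :+ two :* j) := (:- one) :* (two :* two) :* (h :+ j)) refl
    factor : two * (b + - 1ℚ + - (two * ℕ→ℚ j)) ≡ - 1ℚ * (two * two) * (h + ℕ→ℚ j)
    factor = trans (expand b (ℕ→ℚ j)) (trans (cong (λ x → - two * (x + two * ℕ→ℚ j)) (sym h+h≡1-b)) (refold h (ℕ→ℚ j)))

  -- Taking out the variables one at a time

  tabulate-∷ʳ : ∀ (g : ℕ → ℕ) n →
    tabulate {n = suc n} (λ j → g (toℕ j)) ≡ tabulate {n = n} (λ j → g (toℕ j)) ∷ʳ g n
  tabulate-∷ʳ g zero    = refl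
  tabulate-∷ʳ g (suc n) = cong (g 0 ∷_) (tabulate-∷ʳ (λ m → g (suc m)) n)

  tabulate-0 : ∀ (g : ℕ → ℕ) n → (∀ m → m ℕ.< n → g m ≡ 0) → tabulate {n = n} (λ j → g (toℕ j)) ≡ zeroV
  tabulate-0 g zero    g≡0 = refl
  tabulate-0 g (suc n) g≡0 =
    cong₂ _∷_ (g≡0 0 (ℕ.s≤s ℕ.z≤n)) (tabulate-0 (λ m → g (suc m)) n λ m m<n → g≡0 (suc m) (ℕ.s≤s m<n))

  entry : ℕ → ℕ → ℕ
  entry i m = if does (suc m ℕ.≟ i) then 1 else 0

  entry-≢ : ∀ {m i} → m ≢ i → entry (suc i) m ≡ 0
  entry-≢ {m} {i} m≢i = cong (λ t → if t then 1 else 0) (dec-false (suc m ℕ.≟ suc i) λ e → m≢i (ℕP.suc-injective e))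

  unit-∷ʳ : ∀ {n i} → i ℕ.< n → unit {suc n} (suc i) ≡ unit {n} (suc i) ∷ʳ 0
  unit-∷ʳ {n} {i} i<n = trans (tabulate-∷ʳ (entry (suc i)) n)
    (cong (unit {n} (suc i) ∷ʳ_) (entry-≢ (λ n≡i → ℕP.<⇒≢ i<n (sym n≡i))))

  unit-last : ∀ n → unit {suc n} (suc n) ≡ zeroV ∷ʳ 1
  unit-last n = trans (tabulate-∷ʳ (entry (suc n)) n) (cong₂ _∷ʳ_
    (tabulate-0 (entry (suc n)) n λ m m<n → entry-≢ (ℕP.<⇒≢ m<n))
    (cong (λ t → if t then 1 else 0) (dec-true (suc n ℕ.≟ suc n) refl)))

  replicate-∷ʳ : ∀ n (j : ℕ) → Vec.replicate (suc n) j ≡ Vec.replicate n j ∷ʳ j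
  replicate-∷ʳ zero    j = refl
  replicate-∷ʳ (suc n) j = cong (j ∷_) (replicate-∷ʳ n j)

  X-∷ʳ : ∀ {n} i (v : Vec ℕ n) k (α : Vec ℕ n) m → unit (suc i) ≡ v ∷ʳ k → X (suc i) (α ∷ʳ m) ≡ δ (v ∷ʳ k) (α ∷ʳ m)
  X-∷ʳ i v k α m e = trans (X-δ (suc i) (α ∷ʳ m)) (cong (λ u → δ u (α ∷ʳ m)) e)

  ≃-X : ∀ {n i} → i ℕ.< n → X {suc n} (suc i) ≃ X {n} (suc i) + 0ℚ ·x
  ≃-X {n} {i} i<n = record
    { slice-0  = λ α → trans (X-∷ʳ i (unit (suc i)) 0 α 0 u) (trans (δ-∷ʳ (unit (suc i)) α 0) (sym (X-δ (suc i) α)))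
    ; slice-1  = λ α → trans (X-∷ʳ i (unit (suc i)) 0 α 1 u) (trans (δ-∷ʳ-≢ (unit (suc i)) α λ ()) (sym (zeroˡ _)))
    ; slice-2+ = λ k α → trans (X-∷ʳ i (unit (suc i)) 0 α (suc (suc k)) u) (δ-∷ʳ-≢ (unit (suc i)) α λ ())
    }
    where u = unit-∷ʳ i<n

  ≃-X-last : ∀ n → X {suc n} (suc n) ≃ zeroS + 1ℚ ·x
  ≃-X-last n = record
    { slice-0  = λ α → trans (X-∷ʳ n zeroV 1 α 0 u) (δ-∷ʳ-≢ zeroV α λ ())
    ; slice-1  = λ α → trans (X-∷ʳ n zeroV 1 α 1 u) (trans (δ-∷ʳ zeroV α 1) (trans (sym (oneS-δ α)) (sym (*-identityˡ _))))
    ; slice-2+ = λ k α → trans (X-∷ʳ n zeroV 1 α (suc (suc k)) u) (δ-∷ʳ-≢ zeroV α λ ())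
    }
    where u = unit-last n

  ≃-zeroS : ∀ {n} → zeroS {suc n} ≃ zeroS + 0ℚ ·x
  ≃-zeroS = record { slice-0 = λ _ → refl ; slice-1 = λ α → sym (zeroˡ (oneS α)) ; slice-2+ = λ _ _ → refl }

  ≃-⊕ : ∀ {n} {M M′ : PS (suc n)} {L L′ c c′} → M ≃ L + c ·x → M′ ≃ L′ + c′ ·x → (M ⊕ M′) ≃ (L ⊕ L′) + (c + c′) ·x
  ≃-⊕ {M = M} {M′} {L} {L′} {c} {c′} e e′ = record
    { slice-0  = λ α → trans (⊕-def M M′ (α ∷ʳ 0)) (trans (cong₂ _+_ (A.slice-0 α) (B.slice-0 α)) (sym (⊕-def L L′ α)))
    ; slice-1  = λ α → trans (⊕-def M M′ (α ∷ʳ 1)) (trans (cong₂ _+_ (A.slice-1 α) (B.slice-1 α)) (sym (distribʳ (oneS α) c c′)))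
    ; slice-2+ = λ k α → trans (⊕-def M M′ (α ∷ʳ suc (suc k))) (trans (cong₂ _+_ (A.slice-2+ k α) (B.slice-2+ k α)) (+-identityˡ 0ℚ))
    }
    where
    module A = _≃_+_·x e
    module B = _≃_+_·x e′

  ≃-cong : ∀ {n} {M M′ : PS (suc n)} {L L′ c c′} → M′ ≈ M → L ≈ L′ → c ≡ c′ → M ≃ L + c ·x → M′ ≃ L′ + c′ ·x
  ≃-cong M≈ L≈ refl e = record
    { slice-0  = λ α → trans (M≈ (α ∷ʳ 0)) (trans (slice-0 α) (L≈ α))
    ; slice-1  = λ α → trans (M≈ (α ∷ʳ 1)) (slice-1 α)
    ; slice-2+ = λ k α → trans (M≈ (α ∷ʳ suc (suc k))) (slice-2+ k α)
    }
    where open _≃_+_·x e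

  sumS-sum : ∀ {n} (fs : List (PS n)) α → sumS fs α ≡ sum (map (λ f → f α) fs)
  sumS-sum []       α = refl
  sumS-sum (f ∷ fs) α = trans (⊕-def f (sumS fs) α) (cong (f α +_) (sumS-sum fs α))

  partialSum-sum : ∀ {n} k (α : Vec ℕ n) → partialSum k α ≡ sum (map (λ i → X (suc i) α) (upTo k))
  partialSum-sum k α = trans (sumS-sum (map (λ i → X (suc i)) (upTo k)) α) (cong sum (sym (L.map-∘ (upTo k))))

  partialSum-suc : ∀ {n} k → partialSum {n} (suc k) ≈ (partialSum k ⊕ X (suc k))
  partialSum-suc k α = begin
    partialSum (suc k) α                                      ≡⟨ partialSum-sum (suc k) α ⟩
    sum (map (λ i → X (suc i) α) (upTo (suc k)))              ≡⟨ sum-upTo-suc (λ i → X (suc i) α) k ⟩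
    sum (map (λ i → X (suc i) α) (upTo k)) + X (suc k) α      ≡⟨ cong (_+ X (suc k) α) (partialSum-sum k α) ⟨
    partialSum k α + X (suc k) α                              ≡⟨ ⊕-def (partialSum k) (X (suc k)) α ⟨
    (partialSum k ⊕ X (suc k)) α                              ∎

  ≃-partialSum : ∀ {n k} → k ≤ n → partialSum {suc n} k ≃ partialSum {n} k + 0ℚ ·x
  ≃-partialSum {k = zero}  _   = ≃-zeroS
  ≃-partialSum {k = suc k} k<n = ≃-cong (partialSum-suc k) (λ α → sym (partialSum-suc k α)) (+-identityˡ 0ℚ)
    (≃-⊕ (≃-partialSum (ℕP.<⇒≤ k<n)) (≃-X k<n))

  ≃-partialSum-last : ∀ n → partialSum {suc n} (suc n) ≃ partialSum n + 1ℚ ·x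
  ≃-partialSum-last n = ≃-cong (partialSum-suc n)
    (λ α → trans (⊕-def (partialSum n) zeroS α) (+-identityʳ _)) (+-identityˡ 1ℚ)
    (≃-⊕ (≃-partialSum ℕP.≤-refl) (≃-X-last n))

  -- The number `m` of variables is free because this linear form has to be followed from N
  -- variables to N-1 when x_N is removed.
  doubledSum : ∀ {m} n → PS m
  doubledSum n = partialSum n ⊕ (X (suc n) ⊕ X (suc n))

  ≃-doubledSum : ∀ {m n} → n ℕ.< m → doubledSum {suc m} n ≃ doubledSum {m} n + 0ℚ ·x
  ≃-doubledSum n<m = ≃-cong (λ _ → refl) (λ _ → refl) (trans (+-identityˡ _) (+-identityˡ _))
    (≃-⊕ (≃-partialSum (ℕP.<⇒≤ n<m)) (≃-⊕ (≃-X n<m) (≃-X n<m)))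

  ≃-doubledSum-last : ∀ n → doubledSum {suc n} n ≃ partialSum n + two ·x
  ≃-doubledSum-last n = ≃-cong (λ _ → refl)
    (λ α → trans (⊕-def (partialSum n) (zeroS ⊕ zeroS) α)
                 (trans (cong (partialSum n α +_) (trans (⊕-def zeroS zeroS α) (+-identityˡ 0ℚ))) (+-identityʳ _)))
    (+-identityˡ two)
    (≃-⊕ (≃-partialSum ℕP.≤-refl) (≃-⊕ (≃-X-last n) (≃-X-last n)))

  ZeroConstantTerm-≃ : ∀ {n} {M : PS (suc n)} {L c} → M ≃ L + c ·x → ZeroConstantTerm L → ZeroConstantTerm M
  ZeroConstantTerm-≃ e L₀ α deg≡0 with Vec.initLast α
  ... | β , j , refl with ℕP.m+n≡0⇒n≡0 (deg β) (trans (sym (deg-∷ʳ β j)) deg≡0)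
  ... | refl = trans (_≃_+_·x.slice-0 e β) (L₀ β (ℕP.m+n≡0⇒m≡0 (deg β) (trans (sym (deg-∷ʳ β 0)) deg≡0)))

  ZeroConstantTerm-partialSum : ∀ n → ZeroConstantTerm (partialSum {n} n)
  ZeroConstantTerm-partialSum zero    α _ = refl
  ZeroConstantTerm-partialSum (suc n) = ZeroConstantTerm-≃ (≃-partialSum-last n) (ZeroConstantTerm-partialSum n)

  -- `F` does not involve the last variable and is `f` in the others. Such a factor can stay in
  -- place while a coefficient of the last variable is taken from the rest of the product.
  record Lifts {n} (F : PS (suc n)) (f : PS n) : Set where
    field
      slice-zero : slice F 0 ≈ f
      slice-suc  : ∀ k α → slice F (suc k) α ≡ 0ℚ

  slice-Lifts-⊛ : ∀ {n} {F : PS (suc n)} {f} → Lifts F f → ∀ G j → slice (F ⊛ G) j ≈ (f ⊛ slice G j)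
  slice-Lifts-⊛ {F = F} {f} F↑f G j α = begin
    slice (F ⊛ G) j α                                  ≡⟨ slice-⊛ F G j α ⟩
    conv j (λ i k → (slice F i ⊛ slice G k) α)         ≡⟨ conv-head j (λ i k → ⊛-zeroˡ (slice G k) (slice-suc i) α) ⟩
    (slice F 0 ⊛ slice G j) α                          ≡⟨ ⊛-congʳ (slice G j) slice-zero α ⟩
    (f ⊛ slice G j) α                                  ∎
    where open Lifts F↑f

  Lifts-⊛ : ∀ {n} {F G : PS (suc n)} {f g} → Lifts F f → Lifts G g → Lifts (F ⊛ G) (f ⊛ g)
  Lifts-⊛ {G = G} {f} {g} F↑f G↑g = record
    { slice-zero = λ α → trans (slice-Lifts-⊛ F↑f G 0 α) (⊛-congˡ f (Lifts.slice-zero G↑g) α)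
    ; slice-suc  = λ k α → trans (slice-Lifts-⊛ F↑f G (suc k) α)
        (trans (⊛-comm f (slice G (suc k)) α) (⊛-zeroˡ f (Lifts.slice-suc G↑g k) α))
    }

  Lifts-oneS : ∀ {n} → Lifts (oneS {suc n}) oneS
  Lifts-oneS = record { slice-zero = oneS-∷ʳ-0 ; slice-suc = λ k α → oneS-∷ʳ-suc α k }

  Lifts-cong : ∀ {n} {F F′ : PS (suc n)} {f f′} → F′ ≈ F → f ≈ f′ → Lifts F f → Lifts F′ f′
  Lifts-cong F≈ f≈ F↑f = record
    { slice-zero = λ α → trans (F≈ (α ∷ʳ 0)) (trans (Lifts.slice-zero F↑f α) (f≈ α))
    ; slice-suc  = λ k α → trans (F≈ (α ∷ʳ suc k)) (Lifts.slice-suc F↑f k α)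
    }

  Lifts-onePlusPow : ∀ {n} {M : PS (suc n)} {L} a → M ≃ L + 0ℚ ·x → Lifts (onePlusPow a M) (onePlusPow a L)
  Lifts-onePlusPow {L = L} a e = record
    { slice-zero = slice-onePlusPow-0 e a
    ; slice-suc  = λ k α → begin
        slice (onePlusPow a _) (suc k) α
          ≡⟨ slice-onePlusPow e a (suc k) α ⟩
        (binomℚ a (suc k) * (0ℚ ^ℚ suc k)) * onePlusPow (a + - ℕ→ℚ (suc k)) L α
          ≡⟨ cong (λ x → (binomℚ a (suc k) * x) * onePlusPow (a + - ℕ→ℚ (suc k)) L α) (trans (^ℚ-suc 0ℚ k) (zeroˡ _)) ⟩
        (binomℚ a (suc k) * 0ℚ) * onePlusPow (a + - ℕ→ℚ (suc k)) L α
          ≡⟨ trans (cong (_* onePlusPow (a + - ℕ→ℚ (suc k)) L α) (zeroʳ (binomℚ a (suc k)))) (zeroˡ _) ⟩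
        0ℚ ∎
    }

  prodS-++ : ∀ {n} (fs gs : List (PS n)) → prodS (fs ++ gs) ≈ (prodS fs ⊛ prodS gs)
  prodS-++ []       gs α = sym (⊛-identityˡ (prodS gs) α)
  prodS-++ (f ∷ fs) gs α = trans (⊛-congˡ f (prodS-++ fs gs) α) (sym (⊛-assoc f (prodS fs) (prodS gs) α))

  factor : ∀ {n} → (ℕ → ℚ) → ℕ → PS n
  factor β i = onePlusPow (β (suc i)) (partialSum (suc i))

  -- `R bs` is definitionally `factors (at bs) N`. The number of factors is independent of the
  -- number of variables, so that the first k factors can be compared across rings; for the same
  -- reason the exponents form a function on ℕ.
  factors : ∀ {n} → (ℕ → ℚ) → ℕ → PS n
  factors β k = prodS (map (factor β) (upTo k))

  factors-suc : ∀ {n} β k → factors {n} β (suc k) ≈ (factors β k ⊛ factor β k)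
  factors-suc β k α = begin
    prodS (map (factor β) (upTo (suc k))) α                          ≡⟨ cong (λ xs → prodS (map (factor β) xs) α) (L.upTo-∷ʳ k) ⟨
    prodS (map (factor β) (upTo k ++ k ∷ [])) α                      ≡⟨ cong (λ fs → prodS fs α) (L.map-++ (factor β) (upTo k) (k ∷ [])) ⟩
    prodS (map (factor β) (upTo k) ++ factor β k ∷ []) α             ≡⟨ prodS-++ (map (factor β) (upTo k)) (factor β k ∷ []) α ⟩
    (factors β k ⊛ (factor β k ⊛ oneS)) α                            ≡⟨ ⊛-congˡ (factors β k) (⊛-identityʳ (factor β k)) α ⟩
    (factors β k ⊛ factor β k) α                                     ∎

  Lifts-factors : ∀ {n} β {k} → k ≤ n → Lifts (factors {suc n} β k) (factors β k)
  Lifts-factors β {zero}  _   = Lifts-oneS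
  Lifts-factors β {suc k} k<n = Lifts-cong (factors-suc β k) (λ α → sym (factors-suc β k α))
    (Lifts-⊛ (Lifts-factors β (ℕP.<⇒≤ k<n)) (Lifts-onePlusPow (β (suc k)) (≃-partialSum k<n)))

  1^ℚ : ∀ j → 1ℚ ^ℚ j ≡ 1ℚ
  1^ℚ zero    = refl
  1^ℚ (suc j) = trans (^ℚ-suc 1ℚ j) (trans (*-identityˡ _) (1^ℚ j))

  slice-onePlusPow-partialSum : ∀ {n} a j → slice (onePlusPow a (partialSum {suc n} (suc n))) j ≈
    (λ α → binomℚ a j * onePlusPow (a + - ℕ→ℚ j) (partialSum n) α)
  slice-onePlusPow-partialSum {n} a j α = trans (slice-onePlusPow (≃-partialSum-last n) a j α)
    (cong (_* onePlusPow (a + - ℕ→ℚ j) (partialSum n) α) (trans (cong (binomℚ a j *_) (1^ℚ j)) (*-identityʳ _)))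

  -- The diagonal coefficient of (1+x₁)^β₁ ⋯ (1+x₁+…+xₙ)^(βₙ+c), from xₙ down to x₁.
  binomials : (ℕ → ℚ) → ℕ → ℕ → ℚ → ℚ
  binomials β j zero    c = 1ℚ
  binomials β j (suc n) c = binomℚ (β (suc n) + c) j * binomials β j n (β (suc n) + c + - ℕ→ℚ j)

  -- `c` is the exponent left over from the variables already removed. The leftover power has the
  -- same base as the last remaining factor, so `onePlusPow-⊛` merges the two before the next
  -- coefficient is taken.
  Diag-factors : ∀ β j n c → Diag {n} (factors β n ⊛ onePlusPow c (partialSum n)) j ≡ binomials β j n c
  Diag-factors β j zero    c = begin
    (oneS ⊛ onePlusPow c zeroS) []       ≡⟨ ⊛-identityˡ (onePlusPow c zeroS) [] ⟩
    onePlusPow c zeroS []                ≡⟨ onePlusPow-conv c zeroS [] ⟩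
    1ℚ * 1ℚ                              ≡⟨ *-identityˡ 1ℚ ⟩
    1ℚ                                   ∎
  Diag-factors β j (suc n) c = begin
    (factors β (suc n) ⊛ P) (Vec.replicate (suc n) j)
      ≡⟨ cong (factors β (suc n) ⊛ P) (replicate-∷ʳ n j) ⟩
    (factors β (suc n) ⊛ P) (J ∷ʳ j)
      ≡⟨ ⊛-congʳ P (factors-suc β n) (J ∷ʳ j) ⟩
    ((factors β n ⊛ factor β n) ⊛ P) (J ∷ʳ j)
      ≡⟨ ⊛-assoc (factors β n) (factor β n) P (J ∷ʳ j) ⟩
    (factors β n ⊛ (factor β n ⊛ P)) (J ∷ʳ j)
      ≡⟨ ⊛-congˡ (factors β n) (onePlusPow-⊛ (β (suc n)) c (ZeroConstantTerm-partialSum (suc n))) (J ∷ʳ j) ⟩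
    (factors β n ⊛ onePlusPow e (partialSum (suc n))) (J ∷ʳ j)
      ≡⟨ slice-Lifts-⊛ (Lifts-factors β ℕP.≤-refl) (onePlusPow e (partialSum (suc n))) j J ⟩
    (factors β n ⊛ slice (onePlusPow e (partialSum (suc n))) j) J
      ≡⟨ ⊛-congˡ (factors β n) (slice-onePlusPow-partialSum e j) J ⟩
    (factors β n ⊛ (λ α → binomℚ e j * onePlusPow (e + - ℕ→ℚ j) (partialSum n) α)) J
      ≡⟨ ⊛-scaleʳ (binomℚ e j) (factors β n) (onePlusPow (e + - ℕ→ℚ j) (partialSum n)) J ⟩
    binomℚ e j * (factors β n ⊛ onePlusPow (e + - ℕ→ℚ j) (partialSum n)) J
      ≡⟨ cong (binomℚ e j *_) (Diag-factors β j n (e + - ℕ→ℚ j)) ⟩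
    binomials β j (suc n) c ∎
    where
    P = onePlusPow c (partialSum (suc n))
    J = Vec.replicate n j
    e = β (suc n) + c

  -- Every pair i + k = j leaves S^(b-i) S^(κ-k) = S^(b+κ-j), whatever the split. The power of S
  -- therefore comes out of the sum and only the scalar `H b κ j` remains.
  slice-doubled : ∀ n b κ j → slice (onePlusPow b (doubledSum n) ⊛ onePlusPow κ (partialSum (suc n))) j ≈
    (λ α → H b κ j * onePlusPow (b + κ + - ℕ→ℚ j) (partialSum n) α)
  slice-doubled n b κ j α = begin
    slice (A ⊛ P) j α
      ≡⟨ slice-⊛ A P j α ⟩
    conv j (λ i k → (slice A i ⊛ slice P k) α)
      ≡⟨ conv-cong j term ⟩
    conv j (λ i k → E * (binomℚ₂ b i * binomℚ κ k))
      ≡⟨ conv-*ˡ j E (λ i k → binomℚ₂ b i * binomℚ κ k) ⟩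
    E * H b κ j
      ≡⟨ *-comm E _ ⟩
    H b κ j * E ∎
    where
    A = onePlusPow b (doubledSum {suc n} n)
    P = onePlusPow κ (partialSum (suc n))
    E = onePlusPow (b + κ + - ℕ→ℚ j) (partialSum n) α
    collect : ∀ b κ i k → (b + - i) + (κ + - k) ≡ b + κ + - (i + k)
    collect = solve 4 (λ b κ i k → (b :+ :- i) :+ (κ :+ :- k) := b :+ κ :+ :- (i :+ k)) refl
    rotate : ∀ x y z → x * (y * z) ≡ z * (x * y)
    rotate = solve 3 (λ x y z → x :* (y :* z) := z :* (x :* y)) refl
    term : ∀ i k → i ℕ.+ k ≡ j → (slice A i ⊛ slice P k) α ≡ E * (binomℚ₂ b i * binomℚ κ k)
    term i k i+k≡j = begin
      (slice A i ⊛ slice P k) α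
        ≡⟨ ⊛-cong {f′ = λ α → binomℚ₂ b i * A′ α} {g′ = λ α → binomℚ κ k * P′ α}
             (slice-onePlusPow (≃-doubledSum-last n) b i) (slice-onePlusPow-partialSum κ k) α ⟩
      ((λ α → binomℚ₂ b i * A′ α) ⊛ (λ α → binomℚ κ k * P′ α)) α
        ≡⟨ ⊛-scaleˡ (binomℚ₂ b i) A′ (λ α → binomℚ κ k * P′ α) α ⟩
      binomℚ₂ b i * (A′ ⊛ (λ α → binomℚ κ k * P′ α)) α
        ≡⟨ cong (binomℚ₂ b i *_) (⊛-scaleʳ (binomℚ κ k) A′ P′ α) ⟩
      binomℚ₂ b i * (binomℚ κ k * (A′ ⊛ P′) α)
        ≡⟨ cong (λ x → binomℚ₂ b i * (binomℚ κ k * x)) (onePlusPow-⊛ (b + - ℕ→ℚ i) (κ + - ℕ→ℚ k) (ZeroConstantTerm-partialSum n) α) ⟩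
      binomℚ₂ b i * (binomℚ κ k * onePlusPow ((b + - ℕ→ℚ i) + (κ + - ℕ→ℚ k)) (partialSum n) α)
        ≡⟨ cong (λ x → binomℚ₂ b i * (binomℚ κ k * onePlusPow x (partialSum n) α))
             (trans (collect b κ (ℕ→ℚ i) (ℕ→ℚ k)) (cong (λ x → b + κ + - x) (trans (sym (ℕ→ℚ-+ i k)) (cong ℕ→ℚ i+k≡j)))) ⟩
      binomℚ₂ b i * (binomℚ κ k * E)
        ≡⟨ rotate (binomℚ₂ b i) (binomℚ κ k) E ⟩
      E * (binomℚ₂ b i * binomℚ κ k) ∎
      where
      A′ = onePlusPow (b + - ℕ→ℚ i) (partialSum n)
      P′ = onePlusPow (κ + - ℕ→ℚ k) (partialSum n)

  Diag-doubled : ∀ n β b j → β (suc n) + β (suc (suc n)) ≡ - 1ℚ →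
    let κ = - ℕ→ℚ (suc j) in
    Diag {suc (suc n)} (onePlusPow b (doubledSum n) ⊛ factors β (suc (suc n))) j ≡
      binomℚ (β (suc (suc n))) j * (H b κ j * binomials β j n (b + κ + - ℕ→ℚ j))
  Diag-doubled n β b j β+β≡-1 = begin
    (A ⊛ factors β (suc (suc n))) (Vec.replicate (suc (suc n)) j)
      ≡⟨ cong (A ⊛ factors β (suc (suc n))) (replicate-∷ʳ (suc n) j) ⟩
    (A ⊛ factors β (suc (suc n))) (J′ ∷ʳ j)
      ≡⟨ ⊛-congˡ A (factors-suc β (suc n)) (J′ ∷ʳ j) ⟩
    (A ⊛ (factors β (suc n) ⊛ factor β (suc n))) (J′ ∷ʳ j)
      ≡⟨ ⊛-assoc A (factors β (suc n)) (factor β (suc n)) (J′ ∷ʳ j) ⟨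
    ((A ⊛ factors β (suc n)) ⊛ factor β (suc n)) (J′ ∷ʳ j)
      ≡⟨ slice-Lifts-⊛ (Lifts-⊛ (Lifts-onePlusPow b (≃-doubledSum ℕP.≤-refl)) (Lifts-factors β ℕP.≤-refl)) (factor β (suc n)) j J′ ⟩
    ((A′ ⊛ factors β (suc n)) ⊛ slice (factor β (suc n)) j) J′
      ≡⟨ ⊛-congˡ (A′ ⊛ factors β (suc n)) (slice-onePlusPow-partialSum e j) J′ ⟩
    ((A′ ⊛ factors β (suc n)) ⊛ (λ α → binomℚ e j * P α)) J′
      ≡⟨ ⊛-scaleʳ (binomℚ e j) (A′ ⊛ factors β (suc n)) P J′ ⟩
    binomℚ e j * ((A′ ⊛ factors β (suc n)) ⊛ P) J′
      ≡⟨ cong (binomℚ e j *_) rest ⟩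
    binomℚ e j * (H b κ j * binomials β j n (b + κ + - ℕ→ℚ j)) ∎
    where
    κ = - ℕ→ℚ (suc j)
    e = β (suc (suc n))
    J = Vec.replicate n j
    J′ = Vec.replicate (suc n) j
    A = onePlusPow b (doubledSum {suc (suc n)} n)
    A′ = onePlusPow b (doubledSum {suc n} n)
    P = onePlusPow (e + - ℕ→ℚ j) (partialSum {suc n} (suc n))
    Q = onePlusPow κ (partialSum {suc n} (suc n))
    neg-sum : ∀ j → - 1ℚ + - j ≡ - (1ℚ + j)
    neg-sum = solve 1 (λ j → :- con 1ℚ :+ :- j := :- (con 1ℚ :+ j)) refl
    exponent : β (suc n) + (e + - ℕ→ℚ j) ≡ κ
    exponent = trans (sym (+-assoc (β (suc n)) e _)) (trans (cong (_+ - ℕ→ℚ j) β+β≡-1)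
      (trans (neg-sum (ℕ→ℚ j)) (cong -_ (sym (ℕ→ℚ-suc j)))))
    -- The first `n` factors are free of x_(N-1). Moving them to the front brings together the two
    -- powers that contain it, and the leftover `P` turns the exponent of the second into `κ`.
    reorder : ((A′ ⊛ factors β (suc n)) ⊛ P) ≈ (factors β n ⊛ (A′ ⊛ Q))
    reorder α = begin
      ((A′ ⊛ factors β (suc n)) ⊛ P) α                     ≡⟨ ⊛-congʳ P (⊛-congˡ A′ (factors-suc β n)) α ⟩
      ((A′ ⊛ (factors β n ⊛ factor β n)) ⊛ P) α            ≡⟨ ⊛-congʳ P (⊛-assoc A′ (factors β n) (factor β n)) α ⟨
      (((A′ ⊛ factors β n) ⊛ factor β n) ⊛ P) α            ≡⟨ ⊛-assoc (A′ ⊛ factors β n) (factor β n) P α ⟩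
      ((A′ ⊛ factors β n) ⊛ (factor β n ⊛ P)) α            ≡⟨ ⊛-cong {f = A′ ⊛ factors β n} {g = factor β n ⊛ P} (⊛-comm A′ (factors β n)) merge α ⟩
      ((factors β n ⊛ A′) ⊛ Q) α                           ≡⟨ ⊛-assoc (factors β n) A′ Q α ⟩
      (factors β n ⊛ (A′ ⊛ Q)) α                           ∎
      where
      merge : (factor β n ⊛ P) ≈ Q
      merge α = trans (onePlusPow-⊛ (β (suc n)) (e + - ℕ→ℚ j) (ZeroConstantTerm-partialSum (suc n)) α)
        (cong (λ x → onePlusPow x (partialSum (suc n)) α) exponent)
    rest : ((A′ ⊛ factors β (suc n)) ⊛ P) J′ ≡ H b κ j * binomials β j n (b + κ + - ℕ→ℚ j)
    rest = begin
      ((A′ ⊛ factors β (suc n)) ⊛ P) J′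
        ≡⟨ reorder J′ ⟩
      (factors β n ⊛ (A′ ⊛ Q)) J′
        ≡⟨ cong (factors β n ⊛ (A′ ⊛ Q)) (replicate-∷ʳ n j) ⟩
      (factors β n ⊛ (A′ ⊛ Q)) (J ∷ʳ j)
        ≡⟨ slice-Lifts-⊛ (Lifts-factors β ℕP.≤-refl) (A′ ⊛ Q) j J ⟩
      (factors β n ⊛ slice (A′ ⊛ Q) j) J
        ≡⟨ ⊛-congˡ (factors β n) (slice-doubled n b κ j) J ⟩
      (factors β n ⊛ (λ α → H b κ j * onePlusPow (b + κ + - ℕ→ℚ j) (partialSum n) α)) J
        ≡⟨ ⊛-scaleʳ (H b κ j) (factors β n) (onePlusPow (b + κ + - ℕ→ℚ j) (partialSum n)) J ⟩
      H b κ j * (factors β n ⊛ onePlusPow (b + κ + - ℕ→ℚ j) (partialSum n)) J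
        ≡⟨ cong (H b κ j *_) (Diag-factors β j n (b + κ + - ℕ→ℚ j)) ⟩
      H b κ j * binomials β j n (b + κ + - ℕ→ℚ j) ∎

  -- Matching the hypergeometric coefficient

  ℕ→ℚ-* : ∀ m n → ℕ→ℚ (m ℕ.* n) ≡ ℕ→ℚ m * ℕ→ℚ n
  ℕ→ℚ-* zero    n = sym (zeroˡ _)
  ℕ→ℚ-* (suc m) n = begin
    ℕ→ℚ (n ℕ.+ m ℕ.* n)            ≡⟨ ℕ→ℚ-+ n (m ℕ.* n) ⟩
    ℕ→ℚ n + ℕ→ℚ (m ℕ.* n)          ≡⟨ cong (ℕ→ℚ n +_) (ℕ→ℚ-* m n) ⟩
    ℕ→ℚ n + ℕ→ℚ m * ℕ→ℚ n          ≡⟨ factor-out (ℕ→ℚ m) (ℕ→ℚ n) ⟩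
    (1ℚ + ℕ→ℚ m) * ℕ→ℚ n           ≡⟨ cong (_* ℕ→ℚ n) (ℕ→ℚ-suc m) ⟨
    ℕ→ℚ (suc m) * ℕ→ℚ n            ∎
    where
    factor-out : ∀ m n → n + m * n ≡ (1ℚ + m) * n
    factor-out = solve 2 (λ m n → n :+ m :* n := (con 1ℚ :+ m) :* n) refl

  ^ℚ-distrib-* : ∀ x y n → (x * y) ^ℚ n ≡ (x ^ℚ n) * (y ^ℚ n)
  ^ℚ-distrib-* x y zero    = sym (*-identityˡ 1ℚ)
  ^ℚ-distrib-* x y (suc n) = begin
    (x * y) ^ℚ suc n                     ≡⟨ ^ℚ-suc (x * y) n ⟩
    (x * y) * ((x * y) ^ℚ n)             ≡⟨ cong ((x * y) *_) (^ℚ-distrib-* x y n) ⟩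
    (x * y) * ((x ^ℚ n) * (y ^ℚ n))      ≡⟨ interchange x y (x ^ℚ n) (y ^ℚ n) ⟩
    (x * (x ^ℚ n)) * (y * (y ^ℚ n))      ≡⟨ cong₂ _*_ (^ℚ-suc x n) (^ℚ-suc y n) ⟨
    (x ^ℚ suc n) * (y ^ℚ suc n)          ∎

  ^ℚ-exchange : ∀ x m n → (x ^ℚ m) ^ℚ n ≡ (x ^ℚ n) ^ℚ m
  ^ℚ-exchange x zero    n = 1^ℚ n
  ^ℚ-exchange x (suc m) n = begin
    (x ^ℚ suc m) ^ℚ n               ≡⟨ cong (_^ℚ n) (^ℚ-suc x m) ⟩
    (x * (x ^ℚ m)) ^ℚ n             ≡⟨ ^ℚ-distrib-* x (x ^ℚ m) n ⟩
    (x ^ℚ n) * ((x ^ℚ m) ^ℚ n)      ≡⟨ cong ((x ^ℚ n) *_) (^ℚ-exchange x m n) ⟩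
    (x ^ℚ n) * ((x ^ℚ n) ^ℚ m)      ≡⟨ ^ℚ-suc (x ^ℚ n) m ⟨
    (x ^ℚ n) ^ℚ suc m               ∎

  -- Used at q = m = N: it splits the j-th power of the argument (-N)^N into N^(Nj) and N copies of
  -- (-1)^j, one for each variable.
  sign-^ : ∀ q m j → ((- q) ^ℚ m) ^ℚ j ≡ (((- 1ℚ) ^ℚ j) ^ℚ m) * ((q ^ℚ m) ^ℚ j)
  sign-^ q m j = begin
    ((- q) ^ℚ m) ^ℚ j                              ≡⟨ cong (λ x → (x ^ℚ m) ^ℚ j) (neg q) ⟩
    ((- 1ℚ * q) ^ℚ m) ^ℚ j                         ≡⟨ cong (_^ℚ j) (^ℚ-distrib-* (- 1ℚ) q m) ⟩
    (((- 1ℚ) ^ℚ m) * (q ^ℚ m)) ^ℚ j                ≡⟨ ^ℚ-distrib-* ((- 1ℚ) ^ℚ m) (q ^ℚ m) j ⟩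
    (((- 1ℚ) ^ℚ m) ^ℚ j) * ((q ^ℚ m) ^ℚ j)         ≡⟨ cong (_* ((q ^ℚ m) ^ℚ j)) (^ℚ-exchange (- 1ℚ) m j) ⟩
    (((- 1ℚ) ^ℚ j) ^ℚ m) * ((q ^ℚ m) ^ℚ j)         ∎
    where
    neg : ∀ q → - q ≡ - 1ℚ * q
    neg = solve 1 (λ q → :- q := (:- con 1ℚ) :* q) refl

  prod-* : ∀ {A : Set} (f g : A → ℚ) xs → prod (map (λ x → f x * g x) xs) ≡ prod (map f xs) * prod (map g xs)
  prod-* f g []       = sym (*-identityˡ 1ℚ)
  prod-* f g (x ∷ xs) = trans (cong ((f x * g x) *_) (prod-* f g xs)) (interchange (f x) (g x) _ _)

  prod-const : ∀ c n → prod (map (λ _ → c) (upTo n)) ≡ c ^ℚ n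
  prod-const c zero    = refl
  prod-const c (suc n) = trans (prod-upTo-suc (λ _ → c) n)
    (trans (cong (_* c) (prod-const c n)) (trans (*-comm _ c) (sym (^ℚ-suc c n))))

  prod-replicate : ∀ (f : ℚ → ℚ) x n → prod (map f (replicate n x)) ≡ f x ^ℚ n
  prod-replicate f x zero    = refl
  prod-replicate f x (suc n) = trans (cong (f x *_) (prod-replicate f x n)) (sym (^ℚ-suc (f x) n))

  prod-concatMap : ∀ {A B : Set} (f : B → ℚ) (h : A → List B) xs →
    prod (map f (concatMap h xs)) ≡ prod (map (λ x → prod (map f (h x))) xs)
  prod-concatMap f h []       = refl
  prod-concatMap f h (x ∷ xs) = begin
    prod (map f (h x ++ concatMap h xs))                  ≡⟨ cong prod (L.map-++ f (h x) (concatMap h xs)) ⟩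
    prod (map f (h x) ++ map f (concatMap h xs))          ≡⟨ prod-++ (map f (h x)) _ ⟩
    prod (map f (h x)) * prod (map f (concatMap h xs))    ≡⟨ cong (prod (map f (h x)) *_) (prod-concatMap f h xs) ⟩
    prod (map f (h x)) * prod (map (λ x → prod (map f (h x))) xs) ∎

  prod-≢0 : ∀ {A : Set} (f : A → ℚ) {xs} → All (λ x → f x ≢ 0ℚ) xs → prod (map f xs) ≢ 0ℚ
  prod-≢0 f []           = λ ()
  prod-≢0 f (fx≢0 ∷ all) = *-≢0 fx≢0 (prod-≢0 f all)

  poch-≢0 : ∀ {x} → (∀ j → x + ℕ→ℚ j ≢ 0ℚ) → ∀ j → poch x j ≢ 0ℚ
  poch-≢0 x+j≢0 zero    = λ ()
  poch-≢0 x+j≢0 (suc j) e = *-≢0 (poch-≢0 x+j≢0 j) (x+j≢0 j) (trans (sym (poch-suc _ j)) e)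

  -- Pochhammer symbols

  poch-1 : ∀ j → poch 1ℚ j ≡ factℚ j
  poch-1 j = begin
    poch 1ℚ j                                    ≡⟨ poch-def 1ℚ j ⟩
    prod (map (λ i → 1ℚ + ℕ→ℚ i) (upTo j))       ≡⟨ cong prod (L.map-cong (λ i → sym (ℕ→ℚ-suc i)) (upTo j)) ⟩
    prod (map (λ i → ℕ→ℚ (suc i)) (upTo j))      ≡⟨ factℚ-def j ⟨
    factℚ j                                      ∎

  poch-+ : ∀ x m n → poch x (m ℕ.+ n) ≡ poch x m * poch (x + ℕ→ℚ m) n
  poch-+ x m zero    = trans (cong (poch x) (ℕP.+-identityʳ m)) (sym (*-identityʳ _))
  poch-+ x m (suc n) = begin
    poch x (m ℕ.+ suc n)                                           ≡⟨ cong (poch x) (ℕP.+-suc m n) ⟩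
    poch x (suc (m ℕ.+ n))                                         ≡⟨ poch-suc x (m ℕ.+ n) ⟩
    poch x (m ℕ.+ n) * (x + ℕ→ℚ (m ℕ.+ n))                         ≡⟨ cong₂ _*_ (poch-+ x m n) (trans (cong (x +_) (ℕ→ℚ-+ m n)) (sym (+-assoc x _ _))) ⟩
    (poch x m * poch (x + ℕ→ℚ m) n) * (x + ℕ→ℚ m + ℕ→ℚ n)          ≡⟨ *-assoc (poch x m) _ _ ⟩
    poch x m * (poch (x + ℕ→ℚ m) n * (x + ℕ→ℚ m + ℕ→ℚ n))          ≡⟨ cong (poch x m *_) (poch-suc (x + ℕ→ℚ m) n) ⟨
    poch x m * poch (x + ℕ→ℚ m) (suc n)                            ∎

  binomℚ-neg : ∀ z j → binomℚ (- z) j * factℚ j ≡ ((- 1ℚ) ^ℚ j) * poch z j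
  binomℚ-neg z zero    = refl
  binomℚ-neg z (suc j) = begin
    binomℚ (- z) (suc j) * factℚ (suc j)                           ≡⟨ cong (binomℚ (- z) (suc j) *_) (factℚ-suc j) ⟩
    binomℚ (- z) (suc j) * (factℚ j * ℕ→ℚ (suc j))                 ≡⟨ rotate (binomℚ (- z) (suc j)) (factℚ j) (ℕ→ℚ (suc j)) ⟩
    (ℕ→ℚ (suc j) * binomℚ (- z) (suc j)) * factℚ j                 ≡⟨ cong (_* factℚ j) (binomℚ-suc (- z) j) ⟩
    ((- z + - ℕ→ℚ j) * binomℚ (- z) j) * factℚ j                   ≡⟨ *-assoc (- z + - ℕ→ℚ j) _ _ ⟩
    (- z + - ℕ→ℚ j) * (binomℚ (- z) j * factℚ j)                   ≡⟨ cong ((- z + - ℕ→ℚ j) *_) (binomℚ-neg z j) ⟩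
    (- z + - ℕ→ℚ j) * (((- 1ℚ) ^ℚ j) * poch z j)                   ≡⟨ regroup z (ℕ→ℚ j) ((- 1ℚ) ^ℚ j) (poch z j) ⟩
    (- 1ℚ * ((- 1ℚ) ^ℚ j)) * (poch z j * (z + ℕ→ℚ j))              ≡⟨ cong₂ _*_ (^ℚ-suc (- 1ℚ) j) (poch-suc z j) ⟨
    ((- 1ℚ) ^ℚ suc j) * poch z (suc j)                             ∎
    where
    rotate : ∀ x y z → x * (y * z) ≡ (z * x) * y
    rotate = solve 3 (λ x y z → x :* (y :* z) := (z :* x) :* y) refl
    regroup : ∀ z j s x → (- z + - j) * (s * x) ≡ (- 1ℚ * s) * (x * (z + j))
    regroup = solve 4 (λ z j s x → (:- z :+ :- j) :* (s :* x) := ((:- con 1ℚ) :* s) :* (x :* (z :+ j))) refl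

  -- At x = B(k) - b this is the contribution of the block u^k for M = N-k+1 and of v^k for M = N-k.
  pochs : ℚ → ℕ → ℕ → ℚ
  pochs x M j = prod (map (λ a → poch a j) (map (λ m → (x + ℕ→ℚ m) /ℕ M) (upTo M)))

  -- The constant M^(Mj) of Gauss's formula, bracketed as a j-th power to match the power of the
  -- series argument.
  weight : ℕ → ℕ → ℚ
  weight M j = (ℕ→ℚ M ^ℚ M) ^ℚ j

  -- Gauss's multiplication formula for Pochhammer symbols.
  pochs-weight : ∀ x M′ j → let M = suc M′ in pochs x M j * weight M j ≡ poch x (j ℕ.* M)
  pochs-weight x M′ j = trans (cong (_* weight M j) (cong prod (sym (L.map-∘ (upTo M))))) (go j)
    where
    M = suc M′
    y : ℕ → ℚ
    y m = (x + ℕ→ℚ m) /ℕ M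
    clear : ∀ j m → (y m + ℕ→ℚ j) * ℕ→ℚ M ≡ (x + ℕ→ℚ (j ℕ.* M)) + ℕ→ℚ m
    clear j m = begin
      (y m + ℕ→ℚ j) * ℕ→ℚ M                 ≡⟨ distribʳ (ℕ→ℚ M) (y m) (ℕ→ℚ j) ⟩
      y m * ℕ→ℚ M + ℕ→ℚ j * ℕ→ℚ M           ≡⟨ cong₂ _+_ (/ℕ-* (x + ℕ→ℚ m) M′) (sym (ℕ→ℚ-* j M)) ⟩
      (x + ℕ→ℚ m) + ℕ→ℚ (j ℕ.* M)           ≡⟨ swap x (ℕ→ℚ m) (ℕ→ℚ (j ℕ.* M)) ⟩
      (x + ℕ→ℚ (j ℕ.* M)) + ℕ→ℚ m           ∎
      where
      swap : ∀ x y z → (x + y) + z ≡ (x + z) + y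
      swap = solve 3 (λ x y z → (x :+ y) :+ z := (x :+ z) :+ y) refl
    -- Raising j by one appends M consecutive factors to the long Pochhammer symbol. They are the
    -- next factors of the M short ones, each scaled by M.
    block : ∀ j → prod (map (λ m → y m + ℕ→ℚ j) (upTo M)) * (ℕ→ℚ M ^ℚ M) ≡ poch (x + ℕ→ℚ (j ℕ.* M)) M
    block j = begin
      prod (map (λ m → y m + ℕ→ℚ j) (upTo M)) * (ℕ→ℚ M ^ℚ M)
        ≡⟨ cong (prod (map (λ m → y m + ℕ→ℚ j) (upTo M)) *_) (prod-const (ℕ→ℚ M) M) ⟨
      prod (map (λ m → y m + ℕ→ℚ j) (upTo M)) * prod (map (λ _ → ℕ→ℚ M) (upTo M))
        ≡⟨ prod-* (λ m → y m + ℕ→ℚ j) (λ _ → ℕ→ℚ M) (upTo M) ⟨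
      prod (map (λ m → (y m + ℕ→ℚ j) * ℕ→ℚ M) (upTo M))
        ≡⟨ cong prod (L.map-cong (clear j) (upTo M)) ⟩
      prod (map (λ m → (x + ℕ→ℚ (j ℕ.* M)) + ℕ→ℚ m) (upTo M))
        ≡⟨ poch-def (x + ℕ→ℚ (j ℕ.* M)) M ⟨
      poch (x + ℕ→ℚ (j ℕ.* M)) M ∎
    go : ∀ j → prod (map (λ m → poch (y m) j) (upTo M)) * weight M j ≡ poch x (j ℕ.* M)
    go zero    = trans (*-identityʳ _) (trans (prod-const 1ℚ M) (1^ℚ M))
    go (suc j) = begin
      prod (map (λ m → poch (y m) (suc j)) (upTo M)) * weight M (suc j)
        ≡⟨ cong₂ _*_ (trans (cong prod (L.map-cong (λ m → poch-suc (y m) j) (upTo M)))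
                            (prod-* (λ m → poch (y m) j) (λ m → y m + ℕ→ℚ j) (upTo M)))
                     (trans (^ℚ-suc (ℕ→ℚ M ^ℚ M) j) (*-comm _ (weight M j))) ⟩
      (prod (map (λ m → poch (y m) j) (upTo M)) * prod (map (λ m → y m + ℕ→ℚ j) (upTo M))) * (weight M j * (ℕ→ℚ M ^ℚ M))
        ≡⟨ interchange _ _ (weight M j) (ℕ→ℚ M ^ℚ M) ⟩
      (prod (map (λ m → poch (y m) j) (upTo M)) * weight M j) * (prod (map (λ m → y m + ℕ→ℚ j) (upTo M)) * (ℕ→ℚ M ^ℚ M))
        ≡⟨ cong₂ _*_ (go j) (block j) ⟩
      poch x (j ℕ.* M) * poch (x + ℕ→ℚ (j ℕ.* M)) M
        ≡⟨ poch-+ x (j ℕ.* M) M ⟨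
      poch x (j ℕ.* M ℕ.+ M)
        ≡⟨ cong (poch x) (ℕP.+-comm (j ℕ.* M) M) ⟩
      poch x (suc j ℕ.* M) ∎

  -- (x)_{j(M+1)} = (x)_{jM} (x+jM)_j
  binomℚ-pochs : ∀ x M′ j → let M = suc M′ in
    ((binomℚ (- (x + ℕ→ℚ M * ℕ→ℚ j)) j * factℚ j) * pochs x M j) * weight M j ≡
    ((- 1ℚ) ^ℚ j) * (pochs x (M ℕ.+ 1) j * weight (suc M) j)
  binomℚ-pochs x M′ j = begin
    ((binomℚ (- (x + ℕ→ℚ M * ℕ→ℚ j)) j * factℚ j) * pochs x M j) * weight M j
      ≡⟨ *-assoc _ (pochs x M j) (weight M j) ⟩
    (binomℚ (- (x + ℕ→ℚ M * ℕ→ℚ j)) j * factℚ j) * (pochs x M j * weight M j)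
      ≡⟨ cong₂ _*_ (trans (binomℚ-neg (x + ℕ→ℚ M * ℕ→ℚ j) j) (cong (λ y → ((- 1ℚ) ^ℚ j) * poch (x + y) j) (trans (*-comm (ℕ→ℚ M) (ℕ→ℚ j)) (sym (ℕ→ℚ-* j M)))))
                   (pochs-weight x M′ j) ⟩
    (((- 1ℚ) ^ℚ j) * poch (x + ℕ→ℚ (j ℕ.* M)) j) * poch x (j ℕ.* M)
      ≡⟨ regroup ((- 1ℚ) ^ℚ j) _ _ ⟩
    ((- 1ℚ) ^ℚ j) * (poch x (j ℕ.* M) * poch (x + ℕ→ℚ (j ℕ.* M)) j)
      ≡⟨ cong (((- 1ℚ) ^ℚ j) *_) (poch-+ x (j ℕ.* M) j) ⟨
    ((- 1ℚ) ^ℚ j) * poch x (j ℕ.* M ℕ.+ j)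
      ≡⟨ cong (λ n → ((- 1ℚ) ^ℚ j) * poch x n) (trans (ℕP.+-comm (j ℕ.* M) j) (sym (ℕP.*-suc j M))) ⟩
    ((- 1ℚ) ^ℚ j) * poch x (j ℕ.* suc M)
      ≡⟨ cong (((- 1ℚ) ^ℚ j) *_) (pochs-weight x M j) ⟨
    ((- 1ℚ) ^ℚ j) * (pochs x (suc M) j * weight (suc M) j)
      ≡⟨ cong (λ n → ((- 1ℚ) ^ℚ j) * (pochs x n j * weight (suc M) j)) (ℕP.+-comm 1 M) ⟩
    ((- 1ℚ) ^ℚ j) * (pochs x (M ℕ.+ 1) j * weight (suc M) j) ∎
    where
    M = suc M′
    regroup : ∀ s x y → (s * x) * y ≡ s * (y * x)
    regroup = solve 3 (λ s x y → (s :* x) :* y := s :* (y :* x)) refl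

  -- The numbers B(k) and the final balance of factors

  Bk-last : ∀ {N} (bs : Vec ℚ N) → Bk bs N ≡ - at bs N
  Bk-last {N} bs = begin
    Bk bs N                                                            ≡⟨ Bk-def bs N ⟩
    - sum (map (λ i → at bs (N ℕ.+ i)) (upTo (suc (N ∸ N))))           ≡⟨ cong (λ m → - sum (map (λ i → at bs (N ℕ.+ i)) (upTo (suc m)))) (ℕP.n∸n≡0 N) ⟩
    - (at bs (N ℕ.+ 0) + 0ℚ)                                           ≡⟨ cong -_ (+-identityʳ _) ⟩
    - at bs (N ℕ.+ 0)                                                  ≡⟨ cong (λ m → - at bs m) (ℕP.+-identityʳ N) ⟩
    - at bs N                                                          ∎

  ∸-suc : ∀ {m n} → m ℕ.< n → n ∸ m ≡ suc (n ∸ suc m)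
  ∸-suc {m} {n} m<n = sym (trans (sym (ℕP.+-∸-assoc 1 m<n)) refl)

  Bk-suc : ∀ {N} (bs : Vec ℚ N) {k} → k ℕ.< N → Bk bs k ≡ Bk bs (suc k) + - at bs k
  Bk-suc {N} bs {k} k<N = begin
    Bk bs k
      ≡⟨ Bk-def bs k ⟩
    - sum (map f (upTo (suc (N ∸ k))))
      ≡⟨ cong (λ m → - sum (map f (upTo (suc m)))) (∸-suc k<N) ⟩
    - (f 0 + sum (map f (applyUpTo suc m)))
      ≡⟨ cong₂ (λ x y → - (x + sum y)) (cong (at bs) (ℕP.+-identityʳ k)) tail ⟩
    - (at bs k + sum (map (λ i → at bs (suc k ℕ.+ i)) (upTo m)))
      ≡⟨ neg-+ (at bs k) _ ⟩
    - sum (map (λ i → at bs (suc k ℕ.+ i)) (upTo m)) + - at bs k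
      ≡⟨ cong (_+ - at bs k) (Bk-def bs (suc k)) ⟨
    Bk bs (suc k) + - at bs k ∎
    where
    m = suc (N ∸ suc k)
    f : ℕ → ℚ
    f i = at bs (k ℕ.+ i)
    tail : map f (applyUpTo suc m) ≡ map (λ i → at bs (suc k ℕ.+ i)) (upTo m)
    tail = begin
      map f (applyUpTo suc m)                          ≡⟨ cong (map f) (L.map-upTo suc m) ⟨
      map f (map suc (upTo m))                         ≡⟨ L.map-∘ (upTo m) ⟨
      map (λ i → f (suc i)) (upTo m)                   ≡⟨ L.map-cong (λ i → cong (at bs) (ℕP.+-suc k i)) (upTo m) ⟩
      map (λ i → at bs (suc k ℕ.+ i)) (upTo m)         ∎
    neg-+ : ∀ x y → - (x + y) ≡ - y + - x
    neg-+ = solve 2 (λ x y → :- (x :+ y) := :- y :+ :- x) refl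

  module _ {n} (bs : Vec ℚ (suc (suc n))) (β+β≡-1 : at bs (suc n) + at bs (suc (suc n)) ≡ - 1ℚ) (b : ℚ) (j : ℕ) where
    private
      N = suc (suc n)
      β = at bs

    -- B(k) − b in the notation of the theorem.
    excess : ℕ → ℚ
    excess k = Bk bs k + - b

    -- The exponent left on 1+x₁+…+x_k when the coefficient of x_kʲ is taken.
    upper : ℕ → ℚ
    upper k = - (excess k + ℕ→ℚ (N ∸ k) * ℕ→ℚ j)

    -- The exponent left by x_(k+1) is `upper (suc k)` less j, and the factor with exponent b_k adds
    -- to it. B(k) = B(k+1) - b_k absorbs b_k, and the lost j raises the multiple of j from N-k-1 to
    -- N-k.
    upper-suc : ∀ {k} → k ℕ.< N → β k + (upper (suc k) + - ℕ→ℚ j) ≡ upper k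
    upper-suc {k} k<N = begin
      β k + (upper (suc k) + - ℕ→ℚ j)
        ≡⟨ regroup (β k) (Bk bs (suc k)) b (ℕ→ℚ (N ∸ suc k)) (ℕ→ℚ j) ⟩
      - (((Bk bs (suc k) + - β k) + - b) + (1ℚ + ℕ→ℚ (N ∸ suc k)) * ℕ→ℚ j)
        ≡⟨ cong₂ (λ x y → - ((x + - b) + y * ℕ→ℚ j)) (Bk-suc bs k<N) (trans (cong ℕ→ℚ (∸-suc k<N)) (ℕ→ℚ-suc (N ∸ suc k))) ⟨
      upper k ∎
      where
      regroup : ∀ β B b M j → β + (- ((B + - b) + M * j) + - j) ≡ - (((B + - β) + - b) + (1ℚ + M) * j)
      regroup = solve 5 (λ β B b M j → β :+ (:- ((B :+ :- b) :+ M :* j) :+ :- j) :=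
        :- (((B :+ :- β) :+ :- b) :+ (con 1ℚ :+ M) :* j)) refl

    -- B(N-1) = 1 by the hypothesis on b_(N-1) + b_N. Hence the total exponent b + κ of the middle
    -- step fits the same closed form, and the remaining variables can start from it.
    upper-last : upper (suc n) ≡ b + - ℕ→ℚ (suc j)
    upper-last = begin
      - ((Bk bs (suc n) + - b) + ℕ→ℚ (N ∸ suc n) * ℕ→ℚ j)
        ≡⟨ cong₂ (λ x y → - ((x + - b) + y * ℕ→ℚ j)) B≡1 (cong ℕ→ℚ (ℕP.m+n∸n≡m 1 n)) ⟩
      - ((1ℚ + - b) + 1ℚ * ℕ→ℚ j)
        ≡⟨ regroup b (ℕ→ℚ j) ⟩
      b + - (1ℚ + ℕ→ℚ j)
        ≡⟨ cong (λ x → b + - x) (ℕ→ℚ-suc j) ⟨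
      b + - ℕ→ℚ (suc j) ∎
      where
      regroup : ∀ b j → - ((1ℚ + - b) + 1ℚ * j) ≡ b + - (1ℚ + j)
      regroup = solve 2 (λ b j → :- ((con 1ℚ :+ :- b) :+ con 1ℚ :* j) := b :+ :- (con 1ℚ :+ j)) refl
      neg-swap : ∀ x y → - y + - x ≡ - (x + y)
      neg-swap = solve 2 (λ x y → :- y :+ :- x := :- (x :+ y)) refl
      neg-neg : - (- 1ℚ) ≡ 1ℚ
      neg-neg = solve 0 (:- (:- con 1ℚ) := con 1ℚ) refl
      B≡1 : Bk bs (suc n) ≡ 1ℚ
      B≡1 = begin
        Bk bs (suc n)                        ≡⟨ Bk-suc bs ℕP.≤-refl ⟩
        Bk bs N + - β (suc n)                ≡⟨ cong (_+ - β (suc n)) (Bk-last bs) ⟩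
        - β N + - β (suc n)                  ≡⟨ neg-swap (β (suc n)) (β N) ⟩
        - (β (suc n) + β N)                  ≡⟨ cong -_ β+β≡-1 ⟩
        - (- 1ℚ)                             ≡⟨ neg-neg ⟩
        1ℚ                                   ∎

    binomials-upper : ∀ m → m ≤ n →
      binomials β j m (upper (suc m) + - ℕ→ℚ j) ≡ prod (map (λ i → binomℚ (upper (suc i)) j) (upTo m))
    binomials-upper zero    _   = refl
    binomials-upper (suc m) m<n = begin
      binomℚ (β (suc m) + c) j * binomials β j m (β (suc m) + c + - ℕ→ℚ j)
        ≡⟨ cong (λ e → binomℚ e j * binomials β j m (e + - ℕ→ℚ j)) (upper-suc (ℕ.s≤s (ℕP.m≤n⇒m≤1+n m<n))) ⟩
      binomℚ (upper (suc m)) j * binomials β j m (upper (suc m) + - ℕ→ℚ j)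
        ≡⟨ cong (binomℚ (upper (suc m)) j *_) (binomials-upper m (ℕP.<⇒≤ m<n)) ⟩
      binomℚ (upper (suc m)) j * prod (map (λ i → binomℚ (upper (suc i)) j) (upTo m))
        ≡⟨ *-comm (binomℚ (upper (suc m)) j) _ ⟩
      prod (map (λ i → binomℚ (upper (suc i)) j) (upTo m)) * binomℚ (upper (suc m)) j
        ≡⟨ prod-upTo-suc (λ i → binomℚ (upper (suc i)) j) m ⟨
      prod (map (λ i → binomℚ (upper (suc i)) j) (upTo (suc m))) ∎
      where c = upper (suc (suc m)) + - ℕ→ℚ j

    private
      s = (- 1ℚ) ^ℚ j
      U V C : ℕ → ℚ
      U i = pochs (excess (suc i)) (N ∸ suc i ℕ.+ 1) j
      V i = pochs (excess (suc i)) (N ∸ suc i) j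
      C i = binomℚ (upper (suc i)) j

    -- By `binomℚ-pochs` the factor for k carries the quotient of the weights at N-k+1 and N-k. Over
    -- k = 1, ..., m all weights cancel except those at N and N-m, and each factor leaves one sign
    -- `s`. The quotients are kept multiplied out.
    telescope : ∀ m → m ≤ n →
      prod (map (λ i → (C i * factℚ j) * V i) (upTo m)) * weight (N ∸ m) j ≡
      (s ^ℚ m) * (prod (map U (upTo m)) * weight N j)
    telescope zero    _   = refl′ (weight N j)
      where
      refl′ : ∀ w → 1ℚ * w ≡ 1ℚ * (1ℚ * w)
      refl′ = solve 1 (λ w → con 1ℚ :* w := con 1ℚ :* (con 1ℚ :* w)) refl
    telescope (suc m) m<n = begin
      prod (map g (upTo (suc m))) * weight M j
        ≡⟨ cong (_* weight M j) (prod-upTo-suc g m) ⟩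
      (prod (map g (upTo m)) * g m) * weight M j
        ≡⟨ *-assoc _ (g m) (weight M j) ⟩
      prod (map g (upTo m)) * (g m * weight M j)
        ≡⟨ cong (prod (map g (upTo m)) *_) step ⟩
      prod (map g (upTo m)) * (s * (U m * weight (N ∸ m) j))
        ≡⟨ regroup _ s (U m) (weight (N ∸ m) j) ⟩
      (prod (map g (upTo m)) * weight (N ∸ m) j) * (s * U m)
        ≡⟨ cong (_* (s * U m)) (telescope m (ℕP.<⇒≤ m<n)) ⟩
      ((s ^ℚ m) * (prod (map U (upTo m)) * weight N j)) * (s * U m)
        ≡⟨ regroup′ (s ^ℚ m) _ (weight N j) s (U m) ⟩
      (s * (s ^ℚ m)) * ((prod (map U (upTo m)) * U m) * weight N j)
        ≡⟨ cong₂ (λ x y → x * (y * weight N j)) (^ℚ-suc s m) (prod-upTo-suc U m) ⟨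
      (s ^ℚ suc m) * (prod (map U (upTo (suc m))) * weight N j) ∎
      where
      M = N ∸ suc m
      g : ℕ → ℚ
      g i = (C i * factℚ j) * V i
      m<N : suc m ℕ.< N
      m<N = ℕ.s≤s (ℕP.m≤n⇒m≤1+n m<n)
      step : g m * weight M j ≡ s * (U m * weight (N ∸ m) j)
      step = trans (go M (∸-suc m<N)) (cong (λ k → s * (U m * weight k j)) (sym (∸-suc (ℕP.<-trans (ℕP.n<1+n m) m<N))))
        where
        -- `binomℚ-pochs` requires a successor, whereas N ∸ suc m does not reduce to one;
        -- generalising over `M` lets the equation be matched.
        go : ∀ M → M ≡ suc (N ∸ suc (suc m)) →
          ((binomℚ (- (excess (suc m) + ℕ→ℚ M * ℕ→ℚ j)) j * factℚ j) * pochs (excess (suc m)) M j) * weight M j ≡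
          s * (pochs (excess (suc m)) (M ℕ.+ 1) j * weight (suc M) j)
        go _ refl = binomℚ-pochs (excess (suc m)) (N ∸ suc (suc m)) j
      regroup : ∀ a s u w → a * (s * (u * w)) ≡ (a * w) * (s * u)
      regroup = solve 4 (λ a s u w → a :* (s :* (u :* w)) := (a :* w) :* (s :* u)) refl
      regroup′ : ∀ a u w s v → (a * (u * w)) * (s * v) ≡ (s * a) * ((u * v) * w)
      regroup′ = solve 5 (λ a u w s v → (a :* (u :* w)) :* (s :* v) := (s :* a) :* ((u :* v) :* w)) refl

    half : ℚ
    half = (1ℚ + - b) /ℕ 2

    half+half : half + half ≡ 1ℚ + - b
    half+half = begin
      half + half              ≡⟨ double half ⟩
      half * two               ≡⟨ cong (half *_) (ℕ→ℚ-suc 1) ⟨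
      half * ℕ→ℚ 2             ≡⟨ /ℕ-* (1ℚ + - b) 1 ⟩
      1ℚ + - b                 ∎
      where
      double : ∀ x → x + x ≡ x * two
      double = solve 1 (λ x → x :+ x := x :* (con 1ℚ :+ con 1ℚ)) refl

    uList-prod : prod (map (λ a → poch a j) (uList bs b)) ≡ prod (map U (upTo n)) * (poch half j * poch (- β N) j)
    uList-prod = begin
      prod (map P (uList bs b))
        ≡⟨ cong (λ us → prod (map P us)) (uList-def bs b) ⟩
      prod (map P (concatMap us (upTo n) ++ half ∷ (- β N) ∷ []))
        ≡⟨ cong prod (L.map-++ P (concatMap us (upTo n)) (half ∷ (- β N) ∷ [])) ⟩
      prod (map P (concatMap us (upTo n)) ++ map P (half ∷ (- β N) ∷ []))
        ≡⟨ prod-++ (map P (concatMap us (upTo n))) (map P (half ∷ (- β N) ∷ [])) ⟩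
      prod (map P (concatMap us (upTo n))) * (P half * (P (- β N) * 1ℚ))
        ≡⟨ cong₂ (λ x y → x * (P half * y)) (prod-concatMap P us (upTo n)) (*-identityʳ (P (- β N))) ⟩
      prod (map U (upTo n)) * (P half * P (- β N)) ∎
      where
      P : ℚ → ℚ
      P a = poch a j
      us : ℕ → List ℚ
      us i = map (λ m → (Bk bs (suc i) + - b + ℕ→ℚ m) /ℕ (N ∸ suc i ℕ.+ 1)) (upTo (N ∸ suc i ℕ.+ 1))

    vList-prod : prod (map (λ a → poch a j) (vList bs b)) ≡ prod (map V (upTo n)) * (factℚ j ^ℚ suc n)
    vList-prod = begin
      prod (map P (vList bs b))
        ≡⟨ cong (λ vs → prod (map P vs)) (vList-def bs b) ⟩
      prod (map P (concatMap vs (upTo n) ++ replicate (suc n) 1ℚ))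
        ≡⟨ cong prod (L.map-++ P (concatMap vs (upTo n)) (replicate (suc n) 1ℚ)) ⟩
      prod (map P (concatMap vs (upTo n)) ++ map P (replicate (suc n) 1ℚ))
        ≡⟨ prod-++ (map P (concatMap vs (upTo n))) (map P (replicate (suc n) 1ℚ)) ⟩
      prod (map P (concatMap vs (upTo n))) * prod (map P (replicate (suc n) 1ℚ))
        ≡⟨ cong₂ _*_ (prod-concatMap P vs (upTo n)) (trans (prod-replicate P 1ℚ (suc n)) (cong (_^ℚ suc n) (poch-1 j))) ⟩
      prod (map V (upTo n)) * (factℚ j ^ℚ suc n) ∎
      where
      P : ℚ → ℚ
      P a = poch a j
      vs : ℕ → List ℚ
      vs i = map (λ m → (Bk bs (suc i) + - b + ℕ→ℚ m) /ℕ (N ∸ suc i)) (upTo (N ∸ suc i))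

    -- The 4^j of the middle step is the lower end of the telescoping product: N - n = 2, and 2^2 =
    -- 4.
    four-^ : (two * two) ^ℚ j ≡ weight (N ∸ n) j
    four-^ = begin
      (two * two) ^ℚ j                     ≡⟨ cong (_^ℚ j) (cong (two *_) (*-identityʳ two)) ⟨
      (two * (two * 1ℚ)) ^ℚ j              ≡⟨ cong (λ x → (x * (x * 1ℚ)) ^ℚ j) (ℕ→ℚ-suc 1) ⟨
      (ℕ→ℚ 2 * (ℕ→ℚ 2 * 1ℚ)) ^ℚ j          ≡⟨ cong (_^ℚ j) (trans (^ℚ-suc (ℕ→ℚ 2) 1) (cong (ℕ→ℚ 2 *_) (^ℚ-suc (ℕ→ℚ 2) 0))) ⟨
      weight 2 j                           ≡⟨ cong (λ M → weight M j) (ℕP.m+n∸n≡m 2 n) ⟨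
      weight (N ∸ n) j                     ∎

    -- The final comparison with denominators multiplied out. The N-1 ones in v and the j! of the
    -- series supply N factorials: one for the binomial of x_N, one for `H`, and one for each of the
    -- n binomials left.
    Diag-clear :
      (binomℚ (β N) j * (H b (- ℕ→ℚ (suc j)) j * prod (map C (upTo n)))) *
        (prod (map (λ a → poch a j) (vList bs b)) * factℚ j) ≡
      prod (map (λ a → poch a j) (uList bs b)) * (((- ℕ→ℚ N) ^ℚ N) ^ℚ j)
    Diag-clear = begin
      (c * (h * ΠC)) * (prod (map (λ a → poch a j) (vList bs b)) * F)
        ≡⟨ cong (λ v → (c * (h * ΠC)) * (v * F)) (trans vList-prod (cong (ΠV *_) (^ℚ-suc F n))) ⟩
      (c * (h * ΠC)) * ((ΠV * (F * (F ^ℚ n))) * F)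
        ≡⟨ regroup c h ΠC ΠV F (F ^ℚ n) ⟩
      ((c * F) * (h * F)) * ((ΠC * (F ^ℚ n)) * ΠV)
        ≡⟨ cong (_* ((ΠC * (F ^ℚ n)) * ΠV)) (cong₂ _*_ c*F (diagonal-H b half+half j)) ⟩
      ((s * poch (- β N) j) * ((s * ((two * two) ^ℚ j)) * poch half j)) * ((ΠC * (F ^ℚ n)) * ΠV)
        ≡⟨ cong₂ (λ x y → ((s * poch (- β N) j) * ((s * x) * poch half j)) * y) four-^ merge ⟩
      ((s * poch (- β N) j) * ((s * weight (N ∸ n) j) * poch half j)) * Π
        ≡⟨ regroup′ s (poch (- β N) j) (weight (N ∸ n) j) (poch half j) Π ⟩
      ((s * s) * (poch half j * poch (- β N) j)) * (Π * weight (N ∸ n) j)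
        ≡⟨ cong (((s * s) * (poch half j * poch (- β N) j)) *_) (telescope n ℕP.≤-refl) ⟩
      ((s * s) * (poch half j * poch (- β N) j)) * ((s ^ℚ n) * (ΠU * weight N j))
        ≡⟨ regroup″ s (poch half j * poch (- β N) j) (s ^ℚ n) ΠU (weight N j) ⟩
      (ΠU * (poch half j * poch (- β N) j)) * ((s * (s * (s ^ℚ n))) * weight N j)
        ≡⟨ cong₂ (λ u x → u * (x * weight N j)) uList-prod (trans (^ℚ-suc s (suc n)) (cong (s *_) (^ℚ-suc s n))) ⟨
      prod (map (λ a → poch a j) (uList bs b)) * ((s ^ℚ N) * weight N j)
        ≡⟨ cong (prod (map (λ a → poch a j) (uList bs b)) *_) (sign-^ (ℕ→ℚ N) N j) ⟨
      prod (map (λ a → poch a j) (uList bs b)) * (((- ℕ→ℚ N) ^ℚ N) ^ℚ j) ∎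
      where
      c = binomℚ (β N) j
      h = H b (- ℕ→ℚ (suc j)) j
      F = factℚ j
      ΠC = prod (map C (upTo n))
      ΠU = prod (map U (upTo n))
      ΠV = prod (map V (upTo n))
      Π = prod (map (λ i → (C i * F) * V i) (upTo n))
      neg-neg : ∀ x → - (- x) ≡ x
      neg-neg = solve 1 (λ x → :- (:- x) := x) refl
      c*F : c * F ≡ s * poch (- β N) j
      c*F = trans (cong (λ x → binomℚ x j * F) (sym (neg-neg (β N)))) (binomℚ-neg (- β N) j)
      merge : (ΠC * (F ^ℚ n)) * ΠV ≡ Π
      merge = sym (trans (prod-* (λ i → C i * F) V (upTo n)) (cong (_* ΠV)
        (trans (prod-* C (λ _ → F) (upTo n)) (cong (ΠC *_) (prod-const F n)))))
      regroup : ∀ c h x v f g → (c * (h * x)) * ((v * (f * g)) * f) ≡ ((c * f) * (h * f)) * ((x * g) * v)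
      regroup = solve 6 (λ c h x v f g → (c :* (h :* x)) :* ((v :* (f :* g)) :* f) := ((c :* f) :* (h :* f)) :* ((x :* g) :* v)) refl
      regroup′ : ∀ s p w q x → ((s * p) * ((s * w) * q)) * x ≡ ((s * s) * (q * p)) * (x * w)
      regroup′ = solve 5 (λ s p w q x → ((s :* p) :* ((s :* w) :* q)) :* x := ((s :* s) :* (q :* p)) :* (x :* w)) refl
      regroup″ : ∀ s p t u w → ((s * s) * p) * (t * (u * w)) ≡ (u * p) * ((s * (s * t)) * w)
      regroup″ = solve 5 (λ s p t u w → ((s :* s) :* p) :* (t :* (u :* w)) := (u :* p) :* ((s :* (s :* t)) :* w)) refl

    Diag-hypCoeff : HypDefined (vList bs b) →
      Diag {N} (onePlusPow b (doubledSum n) ⊛ R bs) j ≡ hypCoeff (uList bs b) (vList bs b) ((- ℕ→ℚ N) ^ℚ N) j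
    Diag-hypCoeff defined = *-cancelʳ D≢0 (begin
      Diag {N} (onePlusPow b (doubledSum n) ⊛ R bs) j * D
        ≡⟨ cong (_* D) (Diag-doubled n β b j β+β≡-1) ⟩
      (binomℚ (β N) j * (H b κ j * binomials β j n (b + κ + - ℕ→ℚ j))) * D
        ≡⟨ cong (λ x → (binomℚ (β N) j * (H b κ j * binomials β j n (x + - ℕ→ℚ j))) * D) upper-last ⟨
      (binomℚ (β N) j * (H b κ j * binomials β j n (upper (suc n) + - ℕ→ℚ j))) * D
        ≡⟨ cong (λ x → (binomℚ (β N) j * (H b κ j * x)) * D) (binomials-upper n ℕP.≤-refl) ⟩
      (binomℚ (β N) j * (H b κ j * prod (map C (upTo n)))) * D
        ≡⟨ Diag-clear ⟩
      Πu * (((- ℕ→ℚ N) ^ℚ N) ^ℚ j)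
        ≡⟨ cong (_* (((- ℕ→ℚ N) ^ℚ N) ^ℚ j)) (÷'-* Πu D≢0) ⟨
      ((Πu ÷' D) * D) * (((- ℕ→ℚ N) ^ℚ N) ^ℚ j)
        ≡⟨ swap (Πu ÷' D) D (((- ℕ→ℚ N) ^ℚ N) ^ℚ j) ⟩
      ((Πu ÷' D) * (((- ℕ→ℚ N) ^ℚ N) ^ℚ j)) * D
        ≡⟨ cong (_* D) (hypCoeff-def (uList bs b) (vList bs b) ((- ℕ→ℚ N) ^ℚ N) j) ⟨
      hypCoeff (uList bs b) (vList bs b) ((- ℕ→ℚ N) ^ℚ N) j * D ∎)
      where
      κ = - ℕ→ℚ (suc j)
      Πu = prod (map (λ a → poch a j) (uList bs b))
      D = prod (map (λ a → poch a j) (vList bs b)) * factℚ j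
      -- Definedness of the series enters here: no Pochhammer symbol of a lower parameter vanishes,
      -- so `÷'` is true division.
      D≢0 : D ≢ 0ℚ
      D≢0 = *-≢0 (prod-≢0 (λ a → poch a j) (All.map (λ x+j≢0 → poch-≢0 x+j≢0 j) (HypDefined-def defined))) (factℚ≢0 j)
      swap : ∀ x y z → (x * y) * z ≡ (x * z) * y
      swap = solve 3 (λ x y z → (x :* y) :* z := (x :* z) :* y) refl

open import Data.Rational using (_+_; -_)

theorem4 : (N : ℕ) → 2 ≤ N → (bs : Vec ℚ N) → at bs N ≢ 0ℚ →
    at bs (N ∸ 1) + at bs N ≡ - 1ℚ → (b : ℚ) →
    HypDefined (vList bs b) →
    ∀ (j : ℕ) →
    Diag ((onePlusPow b (partialSum (N ∸ 2) ⊕ (X (N ∸ 1) ⊕ X (N ∸ 1)))) ⊛ R bs) j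
    ≡ hypCoeff (uList bs b) (vList bs b) ((- ℕ→ℚ N) ^ℚ N) j
-- With N = n+2 the truncated subtractions compute, so the linear form in the statement is
-- `doubledSum n` by definition. Only sum and negation have to be carried over to their opaque
-- copies.
theorem4 (suc (suc n)) _ bs _ β+β≡-1 b defined j = trans
  (Diagonal.Diag-hypCoeff bs
    (trans (sym (Diagonal.+-homo (at bs (suc n)) (at bs (suc (suc n))))) (trans β+β≡-1 (Diagonal.-‿homo 1ℚ)))
    b j defined)
  (cong (λ x → hypCoeff (uList bs b) (vList bs b) (x ^ℚ suc (suc n)) j) (sym (Diagonal.-‿homo (ℕ→ℚ (suc (suc n))))))
theorem4 (suc zero) (ℕ.s≤s ())
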